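{- Suppose there are a constant $c$ and a function $d(n,m)$ with $\lim_{m\to\infty} d(n,m)/m=0$ for every fixed $n$, such that for every $n$, every initial BST $T_0$ on $\{1,\dots,n\}$ and every query sequence $X\in[n]^m$, $$\mathrm{cost}(GF,X,T_0)\le c\cdot \mathrm{cost}(OPT,X,T_0)+d(n,m).$$ Then $c\ge 2$.
   Context: Binary search tree model. Keys are $\{1,\dots,n\}$. A query sequence is $X=[x_1,\dots,x_m]\in[n]^m$ and $T_0$ is an initial binary search tree (BST) on the keys. An algorithm $A$ serves $x_1,\dots,x_m$ in order. Before serving $x_t$ it holds a BST $T_{t-1}$; it searches $x_t$ from the root and may then restructure the tree by rotations into $T_t$. Let $P_t$ be the set of nodes on the root-to-$x_t$ path of $T_{t-1}$, and let $U_t$ be the node set of the minimal subtree containing all edges rotated in transforming $T_{t-1}$ into $T_t$. The cost at time $t$ is $|P_t\cup U_t|$. $\mathrm{cost}(A,X,T_0)$ is the sum of these costs over $t=1,\dots,m$, and $\hat c(A,X,T_0)=\mathrm{cost}(A,X,T_0)/m$. $OPT$ denotes an algorithm of minimum cost on $(X,T_0)$ that knows all of $X$ in advance. Greedy Future ($GF$). After finding $x_t$ in $T_{t-1}$, let $v_1<\dots<v_k$ be the keys on the root-to-$x_t$ path, set $v_0=-\infty$ and $v_{k+1}=+\infty$, and let $R_0,\dots,R_k$ be the subtrees hanging off this path. For each $i$, $\tau(v_i)$ is the smallest $s>t$ with $x_s\in(v_{i-1},v_{i+1})$, or $+\infty$ if there is none. $GF$ rearranges $v_1,\dots,v_k$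 as a treap: a BST in key order and a heap in $\tau$, with the smallest $\tau$ at the top. Ties in $\tau$ are broken in favor of the node of smaller depth in $T_{t-1}$. It then reattaches $R_0,\dots,R_k$ unchanged at their unique positions, giving $T_t$. -}

module Defs where

open import Data.Integer.Base using (+_)
open import Data.Fin.Base using (toℕ)
open import Data.List.Base
  using (List; []; _∷_; _++_; length; head; last; filter; findIndex; concatMap; deduplicate)
open import Data.List.Membership.Propositional using (_∈_)
open import Data.List.Relation.Binary.Subset.Propositional using (_⊆_)
open import Data.Maybe.Base using (maybe′)
open import Data.Nat as ℕ using (ℕ; suc)
import Data.Nat.Properties as ℕ
open import Data.Product.Base using (Σ; ∃; _×_; _,_; proj₁; proj₂)
open import Data.Rational as ℚ using (ℚ; 0ℚ; 1ℚ; ½)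
import Data.Rational.Properties as ℚ
open import Data.Rational.Solver using (module +-*-Solver)
open import Data.Sum.Base using (_⊎_)
open import Data.Tree.Binary using (Tree; leaf; node; foldr; module Prefix; module Infix; module Leaves)
open import Data.Tree.Binary.Relation.Unary.All using (All)
open import Data.Unit.Base using (⊤; tt)
open import Function.Base using (id)
open import Function.Bundles using (_⇔_)
open import Relation.Binary.Core using (Rel)
open import Relation.Binary.Definitions using (tri<; tri≈; tri>)
open import Relation.Binary.PropositionalEquality
  using (_≡_; refl; sym; trans; cong; cong₂; subst)
open import Relation.Nullary.Construct.Add.Extrema using (_±; ⊥±; ⊤±; [_])
open import Relation.Nullary.Construct.Add.Supremum as Sup using (_⁺; ⊤⁺)
open import Relation.Nullary.Decidable using (Dec; _×-dec_)
import Relation.Binary.Construct.Add.Extrema.Strict as ExtremaStrict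
import Relation.Binary.Construct.Add.Supremum.Strict as SupremumStrict
open import Relation.Unary using (U)

open ExtremaStrict ℕ._<_ using (_<±_; <±-dec)
open SupremumStrict ℕ._<_ using (_<⁺_)

------------------------------------------------------------------------
-- Real numbers, as Cauchy sequences of rationals

record ℝ : Set where
  field
    seq    : ℕ → ℚ
    cauchy : ∀ ε → 0ℚ ℚ.< ε →
             ∃ λ N → ∀ i j → N ℕ.≤ i → N ℕ.≤ j → ℚ.∣ seq i ℚ.- seq j ∣ ℚ.≤ ε

open ℝ

infix  4 _≤ℝ_
infixl 6 _+ℝ_
infixr 7 _·_

_≤ℝ_ : Rel ℝ _
x ≤ℝ y = ∀ ε → 0ℚ ℚ.< ε → ∃ λ N → ∀ i → N ℕ.≤ i → seq x i ℚ.≤ seq y i ℚ.+ ε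

fromℚ : ℚ → ℝ
fromℚ q .seq _ = q
fromℚ q .cauchy ε 0<ε =
  0 , λ _ _ _ _ → subst (λ z → ℚ.∣ z ∣ ℚ.≤ ε) (sym (ℚ.+-inverseʳ q)) (ℚ.<⇒≤ 0<ε)

fromℕ : ℕ → ℝ
fromℕ n = fromℚ (+ n ℚ./ 1)

_+ℝ_ : ℝ → ℝ → ℝ
(x +ℝ y) .seq i = seq x i ℚ.+ seq y i
(x +ℝ y) .cauchy ε 0<ε = N ℕ.⊔ M , close
  where
  δ = ½ ℚ.* ε

  0<δ : 0ℚ ℚ.< δ
  0<δ = subst (ℚ._< δ) (ℚ.*-zeroʳ ½) (ℚ.*-monoʳ-<-pos ½ 0<ε)

  N = proj₁ (cauchy x δ 0<δ)
  M = proj₁ (cauchy y δ 0<δ)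

  δ+δ≡ε : δ ℚ.+ δ ≡ ε
  δ+δ≡ε = trans (sym (ℚ.*-distribʳ-+ ε ½ ½)) (ℚ.*-identityˡ ε)

  regroup : ∀ a b c d → (a ℚ.+ b) ℚ.- (c ℚ.+ d) ≡ (a ℚ.- c) ℚ.+ (b ℚ.- d)
  regroup = solve 4 (λ a b c d → (a :+ b) :- (c :+ d) := (a :- c) :+ (b :- d)) refl
    where open +-*-Solver

  close : ∀ i j → N ℕ.⊔ M ℕ.≤ i → N ℕ.⊔ M ℕ.≤ j →
          ℚ.∣ (seq x i ℚ.+ seq y i) ℚ.- (seq x j ℚ.+ seq y j) ∣ ℚ.≤ ε
  close i j p q = begin
    ℚ.∣ (seq x i ℚ.+ seq y i) ℚ.- (seq x j ℚ.+ seq y j) ∣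
      ≡⟨ cong ℚ.∣_∣ (regroup (seq x i) (seq y i) (seq x j) (seq y j)) ⟩
    ℚ.∣ (seq x i ℚ.- seq x j) ℚ.+ (seq y i ℚ.- seq y j) ∣
      ≤⟨ ℚ.∣p+q∣≤∣p∣+∣q∣ (seq x i ℚ.- seq x j) (seq y i ℚ.- seq y j) ⟩
    ℚ.∣ seq x i ℚ.- seq x j ∣ ℚ.+ ℚ.∣ seq y i ℚ.- seq y j ∣
      ≤⟨ ℚ.+-mono-≤
           (proj₂ (cauchy x δ 0<δ) i j (ℕ.m⊔n≤o⇒m≤o N M p) (ℕ.m⊔n≤o⇒m≤o N M q))
           (proj₂ (cauchy y δ 0<δ) i j (ℕ.m⊔n≤o⇒n≤o N M p) (ℕ.m⊔n≤o⇒n≤o N M q)) ⟩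
    δ ℚ.+ δ
      ≡⟨ δ+δ≡ε ⟩
    ε ∎
    where open ℚ.≤-Reasoning

_·_ : ℚ → ℝ → ℝ
(q · x) .seq i = q ℚ.* seq x i
(q · x) .cauchy ε 0<ε = proj₁ (cauchy x δ 0<δ) , close
  where
  b = ℚ.∣ q ∣ ℚ.+ 1ℚ

  instance
    ε-pos : ℚ.Positive ε
    ε-pos = ℚ.positive 0<ε

    b-pos : ℚ.Positive b
    b-pos = ℚ.nonNeg+pos⇒pos ℚ.∣ q ∣ {{ℚ.nonNegative (ℚ.0≤∣p∣ q)}} 1ℚ

    b-nonZero : ℚ.NonZero b
    b-nonZero = ℚ.pos⇒nonZero b

    ∣q∣-nonNeg : ℚ.NonNegative ℚ.∣ q ∣
    ∣q∣-nonNeg = ℚ.nonNegative (ℚ.0≤∣p∣ q)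

    1/b-pos : ℚ.Positive (ℚ.1/ b)
    1/b-pos = ℚ.1/pos⇒pos b

  δ = ℚ.1/ b ℚ.* ε

  instance
    δ-pos : ℚ.Positive δ
    δ-pos = ℚ.pos*pos⇒pos (ℚ.1/ b) ε

    δ-nonNeg : ℚ.NonNegative δ
    δ-nonNeg = ℚ.pos⇒nonNeg δ

  0<δ : 0ℚ ℚ.< δ
  0<δ = ℚ.positive⁻¹ δ

  b*δ≡ε : b ℚ.* δ ≡ ε
  b*δ≡ε = trans (sym (ℚ.*-assoc b (ℚ.1/ b) ε))
                (trans (cong (ℚ._* ε) (ℚ.*-inverseʳ b)) (ℚ.*-identityˡ ε))

  factor : ∀ c u v → c ℚ.* u ℚ.- c ℚ.* v ≡ c ℚ.* (u ℚ.- v)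
  factor = solve 3 (λ c u v → c :* u :- c :* v := c :* (u :- v)) refl
    where open +-*-Solver

  ∣q∣≤b : ℚ.∣ q ∣ ℚ.≤ b
  ∣q∣≤b = subst (ℚ._≤ b) (ℚ.+-identityʳ ℚ.∣ q ∣)
                (ℚ.+-monoʳ-≤ ℚ.∣ q ∣ (ℚ.<⇒≤ (ℚ.positive⁻¹ 1ℚ)))

  close : ∀ i j → proj₁ (cauchy x δ 0<δ) ℕ.≤ i → proj₁ (cauchy x δ 0<δ) ℕ.≤ j →
          ℚ.∣ q ℚ.* seq x i ℚ.- q ℚ.* seq x j ∣ ℚ.≤ ε
  close i j p r = begin
    ℚ.∣ q ℚ.* seq x i ℚ.- q ℚ.* seq x j ∣
      ≡⟨ cong ℚ.∣_∣ (factor q (seq x i) (seq x j)) ⟩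
    ℚ.∣ q ℚ.* (seq x i ℚ.- seq x j) ∣
      ≡⟨ ℚ.∣p*q∣≡∣p∣*∣q∣ q (seq x i ℚ.- seq x j) ⟩
    ℚ.∣ q ∣ ℚ.* ℚ.∣ seq x i ℚ.- seq x j ∣
      ≤⟨ ℚ.*-monoˡ-≤-nonNeg ℚ.∣ q ∣ (proj₂ (cauchy x δ 0<δ) i j p r) ⟩
    ℚ.∣ q ∣ ℚ.* δ
      ≤⟨ ℚ.*-monoʳ-≤-nonNeg δ ∣q∣≤b ⟩
    b ℚ.* δ
      ≡⟨ b*δ≡ε ⟩
    ε ∎
    where open ℚ.≤-Reasoning

_/ℝ_ : ℝ → (m : ℕ) → .{{ℕ.NonZero m}} → ℝ
x /ℝ m = (+ 1 ℚ./ m) · x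

Tendsto0 : (ℕ → ℝ) → Set
Tendsto0 a = ∀ ε → 0ℚ ℚ.< ε →
  ∃ λ M → ∀ m → M ℕ.≤ m → (fromℚ (ℚ.- ε) ≤ℝ a m) × (a m ≤ℝ fromℚ ε)

------------------------------------------------------------------------
-- Binary search trees

BinTree : Set
BinTree = Tree ℕ ⊤

data Ordered : BinTree → Set where
  leaf : Ordered (leaf tt)
  node : ∀ {l k r} → All (ℕ._< k) U l → All (k ℕ.<_) U r →
         Ordered l → Ordered r → Ordered (node l k r)

IsKey : ℕ → ℕ → Set
IsKey n k = (1 ℕ.≤ k) × (k ℕ.≤ n)

IsBST : ℕ → BinTree → Set
IsBST n T = Ordered T × (∀ k → (k ∈ Infix.toList T) ⇔ IsKey n k)

-- A finite tree whose leaves carry trees: a top portion together with the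
-- subtrees hanging off it, listed from left to right by its leaves.
Top : Set
Top = Tree ℕ BinTree

graft : Top → BinTree
graft = foldr node id

-- The search path of x in T, with the subtrees hanging off it.
pathTop : ℕ → BinTree → Top
pathTop x (leaf _) = leaf (leaf tt)
pathTop x (node l k r) with ℕ.<-cmp x k
... | tri< _ _ _ = node (pathTop x l) k (leaf r)
... | tri≈ _ _ _ = node (leaf l) k (leaf r)
... | tri> _ _ _ = node (leaf l) k (pathTop x r)

-- On a path, prefix order lists the nodes from the root downwards.
path : ℕ → BinTree → List ℕ
path x T = Prefix.toList (pathTop x T)

-- The number of nodes, rather than edges, from the root to k.
depth : ℕ → BinTree → ℕ
depth k T = length (path k T)

data _⊑_ (s : BinTree) : BinTree → Set where
  here  : s ⊑ s
  left  : ∀ {l k r} → s ⊑ l → s ⊑ node l k r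
  right : ∀ {l k r} → s ⊑ r → s ⊑ node l k r

-- The keys V form a connected set of nodes of T: being connected, a nonempty
-- such set is a top portion of the tree of all descendants of its highest node.
IsSubtree : List ℕ → BinTree → Set
IsSubtree V T = Σ Top λ S → graft S ⊑ T × V ≡ Infix.toList S

IsMinimalSubtree : List ℕ → List ℕ → BinTree → Set
IsMinimalSubtree ks V T =
  IsSubtree V T × ks ⊆ V × (∀ V′ → IsSubtree V′ T → ks ⊆ V′ → V ⊆ V′)

------------------------------------------------------------------------
-- Serving query sequences

Edge : Set
Edge = ℕ × ℕ

data _⟶[_]_ : BinTree → Edge → BinTree → Set where
  rotʳ : ∀ {a u b v c} → node (node a u b) v c ⟶[ u , v ] node a u (node b v c)
  rotˡ : ∀ {a u b v c} → node a u (node b v c) ⟶[ u , v ] node (node a u b) v c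
  inˡ  : ∀ {l l′ k r e} → l ⟶[ e ] l′ → node l k r ⟶[ e ] node l′ k r
  inʳ  : ∀ {l k r r′ e} → r ⟶[ e ] r′ → node l k r ⟶[ e ] node l k r′

data _⟶*[_]_ : BinTree → List Edge → BinTree → Set where
  []  : ∀ {T} → T ⟶*[ [] ] T
  _∷_ : ∀ {T T′ T″ e es} → T ⟶[ e ] T′ → T′ ⟶*[ es ] T″ → T ⟶*[ e ∷ es ] T″

endpoints : List Edge → List ℕ
endpoints = concatMap λ (u , v) → u ∷ v ∷ []

-- A set of nodes contains a rotated edge when it contains both its endpoints.
-- An edge rotated late need not be an edge of T, but rotations inside a
-- connected set keep it connected, so every intermediate tree has the same
-- minimal subtree.
record Step (T : BinTree) (x : ℕ) (T′ : BinTree) : Set where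
  field
    edges     : List Edge
    rotations : T ⟶*[ edges ] T′
    touched   : List ℕ
    minimal   : IsMinimalSubtree (endpoints edges) touched T

  stepCost : ℕ
  stepCost = length (deduplicate ℕ._≟_ (path x T ++ touched))

open Step public using (edges; stepCost)

data Run : BinTree → List ℕ → Set where
  []  : ∀ {T} → Run T []
  _∷_ : ∀ {T x T′ X} → Step T x T′ → Run T′ X → Run T (x ∷ X)

cost : ∀ {T X} → Run T X → ℕ
cost []      = 0
cost (s ∷ r) = stepCost s ℕ.+ cost r

IsOptimal : ∀ {T X} → Run T X → Set
IsOptimal {T} {X} r = ∀ (r′ : Run T X) → cost r ℕ.≤ cost r′

------------------------------------------------------------------------
-- Greedy Future

pred± : List ℕ → ℕ → ℕ ±
pred± vs v = maybe′ [_] ⊥± (last (filter (ℕ._<? v) vs))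

succ± : List ℕ → ℕ → ℕ ±
succ± vs v = maybe′ [_] ⊤± (head (filter (v ℕ.<?_) vs))

Between : ℕ ± → ℕ ± → ℕ → Set
Between a b x = (a <± [ x ]) × ([ x ] <± b)

between? : ∀ a b x → Dec (Between a b x)
between? a b x = <±-dec ℕ._<?_ a [ x ] ×-dec <±-dec ℕ._<?_ [ x ] b

-- vs is the increasing list of path keys.  Times are counted from the first of
-- the future queries, which does not affect comparisons.
τ : (future vs : List ℕ) → ℕ → ℕ ⁺
τ future vs v =
  maybe′ (λ i → Sup.[ toℕ i ]) ⊤⁺ (findIndex (between? (pred± vs v) (succ± vs v)) future)

data Heap {L : Set} (_≺_ : Rel ℕ _) : Tree ℕ L → Set where
  leaf : ∀ {t} → Heap _≺_ (leaf t)
  node : ∀ {l k r} → All (k ≺_) U l → All (k ≺_) U r →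
         Heap _≺_ l → Heap _≺_ r → Heap _≺_ (node l k r)

module _ (T : BinTree) (x : ℕ) (future : List ℕ) where

  private
    P  = pathTop x T
    vs = Infix.toList P

  _≺_ : Rel ℕ _
  u ≺ v = (τ future vs u <⁺ τ future vs v)
        ⊎ (τ future vs u ≡ τ future vs v × depth u T ℕ.< depth v T)

  record IsGreedyTree (T′ : BinTree) : Set where
    field
      top    : Top
      result : graft top ≡ T′
      nodes  : Infix.toList top ≡ vs
      hung   : Leaves.toList top ≡ Leaves.toList P
      heap   : Heap _≺_ top

-- Only path nodes are rearranged, so only edges between them are rotated.
IsGreedyStep : ∀ {T x T′} → List ℕ → Step T x T′ → Set
IsGreedyStep {T} {x} {T′} future s =
  IsGreedyTree T x future T′ × endpoints (edges s) ⊆ path x T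

IsGreedy : ∀ {T X} → Run T X → Set
IsGreedy []                = ⊤
IsGreedy (_∷_ {X = X} s r) = IsGreedyStep X s × IsGreedy r

{-# OPTIONS --safe #-}

-- Take a gadget with keys A < s < z < p < B, where A and B are copies of the
-- previous gadget, and query it in rounds z, B, A, advancing both copies by one
-- query per round.  In the tree with root p, whose left child s has children A
-- and z, every query makes Greedy Future keep the tree: an ancestor on the path
-- is never needed later than its descendants, and ties favour it.  A round costs
-- 3 + 1 + 2 on top of the costs inside A and B.  The static tree with root z, in
-- which s hangs below A and p below B, pays 1 + 1 + 1 instead.  After k levels
-- Greedy Future pays 6·3ᵏ − 5·2ᵏ per 3ᵏ queries against 3·3ᵏ − 2·2ᵏ.

module Submission where

open import Defs
open import Data.Empty using (⊥)
open import Data.Fin.Base using (toℕ)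
open import Data.Integer.Base as ℤ using (+_)
import Data.Integer.Properties as ℤ
open import Data.List.Base using (List; []; _∷_; _++_; length; head; last; filter; findIndex; deduplicate; map; replicate)
open import Data.List.Membership.Propositional using (_∈_)
open import Data.List.Membership.Propositional.Properties using (∈-++⁺ˡ; ∈-++⁺ʳ)
import Data.List.Properties as List
open import Data.List.Relation.Binary.Subset.Propositional using (_⊆_)
open import Data.List.Relation.Unary.All as All using (All; []; _∷_)
import Data.List.Relation.Unary.All.Properties as All
open import Data.List.Relation.Unary.AllPairs using (AllPairs; []; _∷_)
import Data.List.Relation.Unary.AllPairs.Properties as AllPairs
open import Data.List.Relation.Unary.Any using (here; there)
open import Data.List.Relation.Unary.Unique.Propositional using (Unique)
open import Data.Maybe.Base using (just; nothing; maybe′)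
open import Data.Nat.Base as ℕ using (ℕ; zero; suc; _+_; _*_; _^_; _≤_; _<_; z≤n; s≤s)
open import Data.Nat.ListAction using (sum)
import Data.Nat.Properties as ℕ
import Data.Nat.Tactic.RingSolver as ℕ-Ring
open import Data.Product.Base using (Σ; ∃; _×_; _,_; proj₁; proj₂)
open import Data.Rational.Base as ℚ using (ℚ; mkℚ; 0ℚ; 1ℚ; ½; _/_; toℚᵘ; *<*)
import Data.Rational.Properties as ℚ
open import Data.Rational.Solver using (module +-*-Solver)
open import Data.Rational.Unnormalised.Base as ℚᵘ using (mkℚᵘ; *≡*; *≤*)
import Data.Rational.Unnormalised.Properties as ℚᵘ
open import Data.Sum.Base as Sum using (_⊎_; inj₁; inj₂)
open import Data.Tree.Binary using (Tree; leaf; node; #nodes; module Prefix; module Infix)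
import Data.Tree.Binary.Relation.Unary.All as Tree
open import Data.Unit.Base using (⊤; tt)
open import Function.Base using (_∘_)
open import Function.Bundles using (mk⇔)
open import Level using (0ℓ)
import Relation.Binary.Construct.Add.Extrema.Strict as ExtremaStrict
import Relation.Binary.Construct.Add.Supremum.Strict as SupremumStrict
open import Relation.Binary.Core using (Rel)
open import Relation.Binary.Definitions using (tri<; tri≈; tri>)
open import Relation.Binary.PropositionalEquality using (_≡_; refl; sym; trans; cong; cong₂; subst; subst₂; module ≡-Reasoning)
import Relation.Binary.Reasoning.Setoid as SetoidReasoning
open import Relation.Nullary.Construct.Add.Extrema as Ext using (⊥±; ⊤±)
open import Relation.Nullary.Construct.Add.Supremum as Sup using (_⁺; ⊤⁺)
open import Relation.Nullary.Decidable using (Dec; yes; no; ¬?)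
open import Relation.Nullary.Negation using (¬_; contradiction)
open import Relation.Unary using (Pred; Decidable; U)

open ExtremaStrict _<_ using (_<±_; ⊥±<[_]; [_]<⊤±) renaming ([_] to <±[_])
open SupremumStrict _<_ using (_<⁺_; [_]<⊤⁺) renaming ([_] to <⁺[_])
open ℝ

-- The obstacle is that the copies interleave: the queries of one copy are spread among those of the
-- other. The induction survives because a search inside a copy also visits a separator standing
-- between that copy and every foreign query, so foreign queries fall into no gap of the inner path
-- and leave the comparisons of next access times intact. Nesting is needed since one level gives
-- only 8/5; twice the static cost minus the greedy cost doubles per level while the number of
-- queries triples, whence the limit 2. Both algorithms must start from the same tree, so the cheap
-- run first rotates it into the static one. That price depends on the level alone, and the additive
-- term is sublinear only for fixed n; hence the level is fixed before the number of rounds grows.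

private
  variable
    x k           : ℕ
    l l′ r r′     : BinTree
    T T′ T″       : BinTree
    ed            : Edge
    es fs         : List Edge

-- Infix lists of trees

infix-diff : ∀ {L : Set} (t : Tree ℕ L) xs → Infix.toDiffList t xs ≡ Infix.toList t ++ xs
infix-diff (leaf _)     xs = refl
infix-diff (node l k r) xs = begin
  Infix.toDiffList l (k ∷ Infix.toDiffList r xs)  ≡⟨ infix-diff l _ ⟩
  Infix.toList l ++ k ∷ Infix.toDiffList r xs     ≡⟨ cong (λ z → Infix.toList l ++ k ∷ z) (infix-diff r xs) ⟩
  Infix.toList l ++ (k ∷ Infix.toList r) ++ xs    ≡⟨ List.++-assoc (Infix.toList l) _ xs ⟨
  (Infix.toList l ++ k ∷ Infix.toList r) ++ xs    ≡⟨ cong (_++ xs) (infix-diff l _) ⟨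
  Infix.toList (node l k r) ++ xs                 ∎
  where open ≡-Reasoning

infix-node : ∀ {L : Set} (l : Tree ℕ L) k r →
             Infix.toList (node l k r) ≡ Infix.toList l ++ k ∷ Infix.toList r
infix-node l k r = infix-diff l (k ∷ Infix.toList r)

All⇒infix : ∀ {L : Set} {P : Pred ℕ 0ℓ} {t : Tree ℕ L} → Tree.All P U t → All P (Infix.toList t)
All⇒infix (Tree.leaf _)                       = []
All⇒infix {P = P} (Tree.node {l} {m} {r} ps p qs) =
  subst (All P) (sym (infix-node l m r)) (All.++⁺ (All⇒infix ps) (p ∷ All⇒infix qs))

-- Gaps around path keys and comparison of next access times

Sorted : List ℕ → Set
Sorted = AllPairs _<_

-- The open interval between the neighbours of `v`, expressed without naming them. With one
-- condition per path key, enlarging the path only adds entries to an `All`.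
Gap : List ℕ → ℕ → ℕ → Set
Gap vs v y = All (λ w → (w < v → w < y) × (v < w → y < w)) vs

All-filter⁻ : ∀ {P Q : Pred ℕ 0ℓ} (P? : Decidable P) {xs} →
              All Q (filter P? xs) → All (λ x → P x → Q x) xs
All-filter⁻ P? {[]}     _  = []
All-filter⁻ P? {x ∷ xs} qs with P? x
... | no ¬p = (λ p → contradiction p ¬p) ∷ All-filter⁻ P? qs
... | yes _ with q ∷ qs′ ← qs = (λ _ → q) ∷ All-filter⁻ P? qs′

All-filter⁺ : ∀ {P Q : Pred ℕ 0ℓ} (P? : Decidable P) {xs} →
              All (λ x → P x → Q x) xs → All Q (filter P? xs)
All-filter⁺ P? {[]}     _        = []
All-filter⁺ P? {x ∷ xs} (q ∷ qs) with P? x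
... | no  _ = All-filter⁺ P? qs
... | yes p = q p ∷ All-filter⁺ P? qs

last⁻ : ∀ {ws y} → Sorted ws → maybe′ Ext.[_] ⊥± (last ws) <± Ext.[ y ] → All (_< y) ws
last⁻ {[]}         _              _ = []
last⁻ {x ∷ []}     _              <±[ x<y ] = x<y ∷ []
last⁻ {x ∷ w ∷ ws} ((x<w ∷ _) ∷ ss) h with w<y ∷ rest ← last⁻ {w ∷ ws} ss h =
  ℕ.<-trans x<w w<y ∷ w<y ∷ rest

last⁺ : ∀ {ws y} → All (_< y) ws → maybe′ Ext.[_] ⊥± (last ws) <± Ext.[ y ]
last⁺ {[]}         _          = ⊥±<[ _ ]
last⁺ {x ∷ []}     (x<y ∷ _)  = <±[ x<y ]
last⁺ {x ∷ w ∷ ws} (_ ∷ rest) = last⁺ rest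

head⁻ : ∀ {ws y} → Sorted ws → Ext.[ y ] <± maybe′ Ext.[_] ⊤± (head ws) → All (y <_) ws
head⁻ {[]}     _        _       = []
head⁻ {x ∷ ws} (ss ∷ _) <±[ y<x ] = y<x ∷ All.map (ℕ.<-trans y<x) ss

head⁺ : ∀ {ws y} → All (y <_) ws → Ext.[ y ] <± maybe′ Ext.[_] ⊤± (head ws)
head⁺ {[]}     _         = [ _ ]<⊤±
head⁺ {x ∷ ws} (y<x ∷ _) = <±[ y<x ]

-- In a sorted list the last smaller key is the greatest one and the first larger key the least, so
-- bounding `y` by these two bounds it by all.
Between⇒Gap : ∀ {vs v y} → Sorted vs → Between (pred± vs v) (succ± vs v) y → Gap vs v y
Between⇒Gap {vs} {v} ss (lo , hi) = All.zip
  ( All-filter⁻ (ℕ._<? v) (last⁻ (AllPairs.filter⁺ (ℕ._<? v) ss) lo)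
  , All-filter⁻ (v ℕ.<?_) (head⁻ (AllPairs.filter⁺ (v ℕ.<?_) ss) hi) )

Gap⇒Between : ∀ {vs v y} → Gap vs v y → Between (pred± vs v) (succ± vs v) y
Gap⇒Between {vs} {v} g =
    last⁺ (All-filter⁺ (ℕ._<? v) (All.map proj₁ g))
  , head⁺ (All-filter⁺ (v ℕ.<?_) (All.map proj₂ g))

-- With P and Q the gaps of two keys u and v, this says that τ u ≤ τ v.
data Lead (P Q : Pred ℕ 0ℓ) : List ℕ → Set where
  []   : Lead P Q []
  hit  : ∀ {x xs} → P x → Lead P Q (x ∷ xs)
  miss : ∀ {x xs} → ¬ Q x → Lead P Q xs → Lead P Q (x ∷ xs)

Lead⇒≤ : ∀ {P Q : Pred ℕ 0ℓ} (P? : Decidable P) (Q? : Decidable Q) {xs} → Lead P Q xs →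
         let first : ∀ {R : Pred ℕ 0ℓ} → Decidable R → ℕ ⁺
             first R? = maybe′ (λ i → Sup.[ toℕ i ]) ⊤⁺ (findIndex R? xs)
         in first P? <⁺ first Q? ⊎ first P? ≡ first Q?
Lead⇒≤ P? Q? [] = inj₂ refl
Lead⇒≤ P? Q? {x ∷ xs} ld with P? x | Q? x
... | yes _ | yes _ = inj₂ refl
... | yes _ | no  _ with findIndex Q? xs
...   | just _  = inj₁ <⁺[ s≤s z≤n ]
...   | nothing = inj₁ [ _ ]<⊤⁺
Lead⇒≤ P? Q? {x ∷ xs} (hit p)     | no ¬p | _     = contradiction p ¬p
Lead⇒≤ P? Q? {x ∷ xs} (miss ¬q _) | no ¬p | yes q = contradiction q ¬q
Lead⇒≤ P? Q? {x ∷ xs} (miss _ ld) | no ¬p | no  _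
  with findIndex P? xs | findIndex Q? xs | Lead⇒≤ P? Q? ld
... | just _  | just _  | inj₁ <⁺[ i<j ] = inj₁ <⁺[ s≤s i<j ]
... | just _  | just _  | inj₂ eq      = inj₂ (cong Sup.[_] (cong suc (Sup.[]-injective eq)))
... | just _  | nothing | _            = inj₁ [ _ ]<⊤⁺
... | nothing | just _  | inj₁ ()
... | nothing | just _  | inj₂ ()
... | nothing | nothing | _            = inj₂ refl

Lead-map : ∀ {P P′ Q Q′ : Pred ℕ 0ℓ} → (∀ {y} → P y → P′ y) → (∀ {y} → Q′ y → Q y) →
           ∀ {xs} → Lead P Q xs → Lead P′ Q′ xs
Lead-map f g []          = []
Lead-map f g (hit p)     = hit (f p)
Lead-map f g (miss ¬q l) = miss (¬q ∘ g) (Lead-map f g l)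

Leads : (future vs : List ℕ) → Rel ℕ _
Leads future vs u v = Lead (Gap vs u) (Gap vs v) future

Leads⇒τ : ∀ {future vs u v} → Sorted vs → Leads future vs u v →
          τ future vs u <⁺ τ future vs v ⊎ τ future vs u ≡ τ future vs v
Leads⇒τ {future} {vs} {u} {v} ss ld =
  Lead⇒≤ (between? (pred± vs u) (succ± vs u)) (between? (pred± vs v) (succ± vs v))
         (Lead-map Gap⇒Between (Between⇒Gap ss) ld)

-- Search paths and depths

pathTop-< : x < k → pathTop x (node l k r) ≡ node (pathTop x l) k (leaf r)
pathTop-< {x} {k} x<k with ℕ.<-cmp x k
... | tri< _ _ _   = refl
... | tri≈ x≮k _ _ = contradiction x<k x≮k
... | tri> x≮k _ _ = contradiction x<k x≮k

pathTop-≡ : pathTop k (node l k r) ≡ node (leaf l) k (leaf r)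
pathTop-≡ {k} with ℕ.<-cmp k k
... | tri< _ k≢k _ = contradiction refl k≢k
... | tri≈ _ _ _   = refl
... | tri> _ k≢k _ = contradiction refl k≢k

pathTop-> : k < x → pathTop x (node l k r) ≡ node (leaf l) k (pathTop x r)
pathTop-> {k} {x} k<x with ℕ.<-cmp x k
... | tri< _ _ k≮x = contradiction k<x k≮x
... | tri≈ _ _ k≮x = contradiction k<x k≮x
... | tri> _ _ _   = refl

path-< : x < k → path x (node l k r) ≡ k ∷ path x l
path-< x<k = cong Prefix.toList (pathTop-< x<k)

path-≡ : ∀ {l r} → path k (node l k r) ≡ k ∷ []
path-≡ {k} {l} {r} = cong Prefix.toList (pathTop-≡ {k} {l} {r})

path-> : k < x → path x (node l k r) ≡ k ∷ path x r
path-> k<x = cong Prefix.toList (pathTop-> k<x)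

graft-pathTop : ∀ x T → graft (pathTop x T) ≡ T
graft-pathTop x (leaf _) = refl
graft-pathTop x (node l k r) with ℕ.<-cmp x k
... | tri< _ _ _ = cong (λ t → node t k r) (graft-pathTop x l)
... | tri≈ _ _ _ = refl
... | tri> _ _ _ = cong (node l k) (graft-pathTop x r)

All-pathTop : ∀ {P : Pred ℕ 0ℓ} x → Tree.All P U T → Tree.All P U (pathTop x T)
All-pathTop x (Tree.leaf _) = Tree.leaf tt
All-pathTop x (Tree.node {m = k} ps p qs) with ℕ.<-cmp x k
... | tri< _ _ _ = Tree.node (All-pathTop x ps) p (Tree.leaf tt)
... | tri≈ _ _ _ = Tree.node (Tree.leaf tt) p (Tree.leaf tt)
... | tri> _ _ _ = Tree.node (Tree.leaf tt) p (All-pathTop x qs)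

All-path : ∀ {P : Pred ℕ 0ℓ} x → Tree.All P U T → All P (path x T)
All-path x (Tree.leaf _) = []
All-path x (Tree.node {m = k} ps p qs) with ℕ.<-cmp x k
... | tri< _ _ _ = p ∷ All-path x ps
... | tri≈ _ _ _ = p ∷ []
... | tri> _ _ _ = p ∷ All-path x qs

infix-pathTop-sorted : ∀ x → Ordered T → Sorted (Infix.toList (pathTop x T))
infix-pathTop-sorted x leaf = []
infix-pathTop-sorted x (node {l} {k} {r} l<k k<r ol or) with ℕ.<-cmp x k
... | tri< _ _ _ = subst Sorted (sym (infix-node (pathTop x l) k (leaf r)))
        (AllPairs.++⁺ (infix-pathTop-sorted x ol) ([] ∷ [])
          (All.map (λ w<k → w<k ∷ []) (All⇒infix (All-pathTop x l<k))))
... | tri≈ _ _ _ = [] ∷ []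
... | tri> _ _ _ = All⇒infix (All-pathTop x k<r) ∷ infix-pathTop-sorted x or

path-unique : ∀ x → Ordered T → Unique (path x T)
path-unique x leaf = []
path-unique x (node {k = k} l<k k<r ol or) with ℕ.<-cmp x k
... | tri< _ _ _ = All.map (λ v<k k≡v → ℕ.<⇒≢ v<k (sym k≡v)) (All-path x l<k) ∷ path-unique x ol
... | tri≈ _ _ _ = [] ∷ []
... | tri> _ _ _ = All.map ℕ.<⇒≢ (All-path x k<r) ∷ path-unique x or

universal : ∀ T → Tree.All {N = ℕ} {L = ⊤} U U T
universal (leaf _)     = Tree.leaf tt
universal (node l _ r) = Tree.node (universal l) tt (universal r)

Heap-map : ∀ {L : Set} {P : Pred ℕ 0ℓ} {R S : Rel ℕ 0ℓ} {t : Tree ℕ L} →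
           (∀ {u v} → P u → P v → R u v → S u v) →
           Tree.All P U t → Heap R t → Heap S t
Heap-map f (Tree.leaf _) leaf = leaf
Heap-map {P = P} {R} {S} f (Tree.node pl p pr) (node al ar hl hr) =
  node (go p pl al) (go p pr ar) (Heap-map f pl hl) (Heap-map f pr hr)
  where
  go : ∀ {L : Set} {t : Tree ℕ L} {u} → P u → Tree.All P U t → Tree.All (R u) U t → Tree.All (S u) U t
  go pu (Tree.leaf _)     (Tree.leaf _)        = Tree.leaf tt
  go pu (Tree.node a b c) (Tree.node a′ b′ c′) = Tree.node (go pu a a′) (f pu b b′) (go pu c c′)

Heap-zip : ∀ {L : Set} {R S : Rel ℕ 0ℓ} {t : Tree ℕ L} →
           Heap R t → Heap S t → Heap (λ u v → R u v × S u v) t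
Heap-zip leaf leaf = leaf
Heap-zip {R = R} {S} (node al ar hl hr) (node bl br gl gr) =
  node (go al bl) (go ar br) (Heap-zip hl gl) (Heap-zip hr gr)
  where
  go : ∀ {L : Set} {t : Tree ℕ L} {u} → Tree.All (R u) U t → Tree.All (S u) U t →
       Tree.All (λ v → R u v × S u v) U t
  go (Tree.leaf _) (Tree.leaf _) = Tree.leaf tt
  go (Tree.node a b c) (Tree.node a′ b′ c′) = Tree.node (go a a′) (b , b′) (go c c′)

depth-root : ∀ k {l r} → depth k (node l k r) ≡ 1
depth-root k {l} {r} = cong length (path-≡ {k} {l} {r})

depth-pos : ∀ v → 1 ≤ depth v (node l k r)
depth-pos {l} {k} {r} v with ℕ.<-cmp v k
... | tri< _ _ _ = s≤s z≤n
... | tri≈ _ _ _ = s≤s z≤n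
... | tri> _ _ _ = s≤s z≤n

-- Since `depth` is measured by searching, the order of the tree is used to see that the search for
-- a path key retraces the path; each level then adds one to both depths.
depth-heap : ∀ x → Ordered T → Heap (λ u v → depth u T < depth v T) (pathTop x T)
depth-heap x leaf = leaf
depth-heap x (node {l} {k} {r} l<k k<r ol or) with ℕ.<-cmp x k
... | tri< _ _ _ = node (below l l<k) (Tree.leaf tt)
                     (Heap-map (λ u<k v<k u≺v → subst₂ _<_ (sym (deeper u<k)) (sym (deeper v<k)) (s≤s u≺v))
                               (All-pathTop x l<k) (depth-heap x ol)) leaf
  where
  deeper : ∀ {v} → v < k → depth v (node l k r) ≡ suc (depth v l)
  deeper v<k = cong length (path-< v<k)
  below : ∀ t → Tree.All (_< k) U t → Tree.All (λ v → depth k (node t k r) < depth v (node t k r)) U (pathTop x t)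
  below (leaf _) _ = Tree.leaf tt
  below (node _ _ _) ps = Tree.mapₙ
    (λ {v} v<k → subst₂ _<_ (sym (depth-root k)) (sym (cong length (path-< v<k))) (s≤s (depth-pos v)))
    (All-pathTop x ps)
... | tri≈ _ _ _ = node (Tree.leaf tt) (Tree.leaf tt) leaf leaf
... | tri> _ _ _ = node (Tree.leaf tt) (below r k<r) leaf
                     (Heap-map (λ k<u k<v u≺v → subst₂ _<_ (sym (deeper k<u)) (sym (deeper k<v)) (s≤s u≺v))
                               (All-pathTop x k<r) (depth-heap x or))
  where
  deeper : ∀ {v} → k < v → depth v (node l k r) ≡ suc (depth v r)
  deeper k<v = cong length (path-> k<v)
  below : ∀ t → Tree.All (k <_) U t → Tree.All (λ v → depth k (node l k t) < depth v (node l k t)) U (pathTop x t)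
  below (leaf _) _ = Tree.leaf tt
  below (node _ _ _) ps = Tree.mapₙ
    (λ {v} k<v → subst₂ _<_ (sym (depth-root k)) (sym (cong length (path-> k<v))) (s≤s (depth-pos v)))
    (All-pathTop x ps)

-- Static runs and when they are greedy

stay : ∀ {T x} → Step T x T
stay {T} = record
  { edges     = []
  ; rotations = []
  ; touched   = []
  -- A `Top` that is a single leaf carrying `T` has no keys, so the empty list counts as a subtree.
  ; minimal   = (leaf T , here , refl) , (λ ()) , λ _ _ _ ()
  }

static : ∀ T X → Run T X
static T []      = []
static T (x ∷ X) = stay ∷ static T X

length-dedup-unique : ∀ {xs : List ℕ} → Unique xs → length (deduplicate ℕ._≟_ xs) ≡ length xs
length-dedup-unique u = cong length (dedup u)
  where
  dedup : ∀ {xs : List ℕ} → Unique xs → deduplicate ℕ._≟_ xs ≡ xs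
  dedup []                = refl
  dedup {x ∷ xs} (x∉ ∷ u) = cong (x ∷_)
    (trans (cong (filter (¬? ∘ (x ℕ.≟_))) (dedup u)) (List.filter-all (¬? ∘ (x ℕ.≟_)) x∉))

cost-static : Ordered T → ∀ X → cost (static T X) ≡ sum (map (λ x → depth x T) X)
cost-static o []      = refl
cost-static {T} o (x ∷ X) = cong₂ _+_
  (trans (cong (length ∘ deduplicate ℕ._≟_) (List.++-identityʳ (path x T)))
         (length-dedup-unique (path-unique x o)))
  (cost-static o X)

-- The induction on levels carries `Lead` instead of `τ`: queries inserted into the future shift
-- every index that `τ` counts, whereas a `Lead` merely acquires more `miss` steps.
LeadHeap : List ℕ → Top → Set
LeadHeap future S = Heap (Leads future (Infix.toList S)) S

PathHeap : BinTree → ℕ → List ℕ → Set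
PathHeap T x future = LeadHeap future (pathTop x T)

PathHeaps : BinTree → List ℕ → Set
PathHeaps T []      = ⊤
PathHeaps T (x ∷ X) = PathHeap T x X × PathHeaps T X

-- The search path itself serves as the treap, so only its heap order needs an argument. A `Lead`
-- yields a weak inequality of times, and `depth-heap` decides the ties.
static-greedy : Ordered T → ∀ X → PathHeaps T X → IsGreedy (static T X)
static-greedy o []      _        = tt
static-greedy {T} o (x ∷ X) (h , hs) = (tree , λ ()) , static-greedy o X hs
  where
  sorted : Sorted (Infix.toList (pathTop x T))
  sorted = infix-pathTop-sorted x o

  tree : IsGreedyTree T x X T
  tree = record
    { top    = pathTop x T
    ; result = graft-pathTop x T
    ; nodes  = refl
    ; hung   = refl
    ; heap   = Heap-map (λ _ _ (ld , d<) → Sum.map₂ (_, d<) (Leads⇒τ sorted ld))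
                        (All-pathTop {P = U} x (universal T))
                        (Heap-zip h (depth-heap x o))
    }

-- The gadgets, their keys and the query words

size : ℕ → ℕ
size zero    = 1
size (suc k) = size k + (3 + size k)

-- The keys of a copy of level k placed after the first o keys run from
-- suc o to size k + o.
sep₁ sep₂ centreKey : (k o : ℕ) → ℕ
sep₁      k o = 1 + (size k + o)
centreKey k o = 2 + (size k + o)
sep₂      k o = 3 + (size k + o)

greedyTree : (k o : ℕ) → BinTree
greedyTree zero    o = node (leaf tt) (suc o) (leaf tt)
greedyTree (suc k) o =
  node (node (greedyTree k o) (sep₁ k o) (node (leaf tt) (centreKey k o) (leaf tt)))
       (sep₂ k o)
       (greedyTree k (sep₂ k o))

-- A queried key is named by its place in the gadget, independently of the offset, so that one word
-- drives both copies and depths depend on the address alone.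
data Address : ℕ → Set where
  only        : Address zero
  centre      : ∀ {k} → Address (suc k)
  inˡ inʳ     : ∀ {k} → Address k → Address (suc k)

key : ∀ k → ℕ → Address k → ℕ
key zero    o only    = suc o
key (suc k) o centre  = centreKey k o
key (suc k) o (inˡ w) = key k o w
key (suc k) o (inʳ w) = key k (sep₂ k o) w

expand : ∀ {k} → List (Address k) → List (Address (suc k))
expand []       = []
expand (w ∷ ws) = centre ∷ inʳ w ∷ inˡ w ∷ expand ws

word : ∀ k → ℕ → List (Address k)
word zero    N = replicate N only
word (suc k) N = expand (word k N)

queries : (k o N : ℕ) → List ℕ
queries k o N = map (key k o) (word k N)

Within : (lo hi : ℕ) → Pred ℕ 0ℓ
Within lo hi y = lo < y × y ≤ hi

module Gadget (k o : ℕ) where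

  n s z p : ℕ
  n = size k
  s = sep₁ k o
  z = centreKey k o
  p = sep₂ k o

  s<z : s < z
  s<z = ℕ.≤-refl

  z<p : z < p
  z<p = ℕ.≤-refl

  s<p : s < p
  s<p = ℕ.<-trans s<z z<p

  o≤p : o ≤ p
  o≤p = ℕ.m≤n+m o (3 + n)

  top≡ : n + p ≡ size (suc k) + o
  top≡ = sym (ℕ.+-assoc n (3 + n) o)

  p≤top : p ≤ size (suc k) + o
  p≤top = subst (p ≤_) top≡ (ℕ.m≤n+m p n)

  z≤top : z ≤ size (suc k) + o
  z≤top = ℕ.≤-trans (ℕ.<⇒≤ z<p) p≤top

  widenˡ : ∀ {y} → Within o (n + o) y → Within o (size (suc k) + o) y
  widenˡ (o<y , y≤) = o<y , ℕ.≤-trans y≤ (ℕ.≤-trans (ℕ.m≤n+m (n + o) 2) z≤top)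

  widenʳ : ∀ {y} → Within p (n + p) y → Within o (size (suc k) + o) y
  widenʳ {y} (p<y , y≤) = ℕ.≤-<-trans o≤p p<y , subst (y ≤_) top≡ y≤

  o<s : o < s
  o<s = s≤s (ℕ.m≤n+m o n)

key-within : ∀ k o w → Within o (size k + o) (key k o w)
key-within zero    o only    = ℕ.≤-refl , ℕ.≤-refl
key-within (suc k) o centre  = ℕ.<-trans o<s s<z , z≤top
  where open Gadget k o
key-within (suc k) o (inˡ w) = Gadget.widenˡ k o (key-within k o w)
key-within (suc k) o (inʳ w) = Gadget.widenʳ k o (key-within k (sep₂ k o) w)

greedyTree-within : ∀ k o → Tree.All (Within o (size k + o)) U (greedyTree k o)
greedyTree-within zero    o = Tree.node (Tree.leaf tt) (ℕ.≤-refl , ℕ.≤-refl) (Tree.leaf tt)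
greedyTree-within (suc k) o = Tree.node
  (Tree.node (Tree.mapₙ widenˡ (greedyTree-within k o))
             (o<s , ℕ.≤-trans (ℕ.<⇒≤ s<z) z≤top)
             (Tree.node (Tree.leaf tt) (ℕ.<-trans o<s s<z , z≤top) (Tree.leaf tt)))
  (ℕ.<-trans o<s s<p , p≤top)
  (Tree.mapₙ widenʳ (greedyTree-within k p))
  where open Gadget k o

greedyTree-ordered : ∀ k o → Ordered (greedyTree k o)
greedyTree-ordered zero    o = node (Tree.leaf tt) (Tree.leaf tt) leaf leaf
greedyTree-ordered (suc k) o = node
  (Tree.node (Tree.mapₙ (λ y∈ → ℕ.<-trans (s≤s (proj₂ y∈)) s<p) (greedyTree-within k o))
             s<p
             (Tree.node (Tree.leaf tt) z<p (Tree.leaf tt)))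
  (Tree.mapₙ proj₁ (greedyTree-within k p))
  (node (Tree.mapₙ (s≤s ∘ proj₂) (greedyTree-within k o))
        (Tree.node (Tree.leaf tt) s<z (Tree.leaf tt))
        (greedyTree-ordered k o)
        (node (Tree.leaf tt) (Tree.leaf tt) leaf leaf))
  (greedyTree-ordered k p)
  where open Gadget k o

greedyTree-complete : ∀ k o {y} → Within o (size k + o) y → y ∈ Infix.toList (greedyTree k o)
greedyTree-complete zero    o (o<y , y≤) = here (ℕ.≤-antisym y≤ o<y)
greedyTree-complete (suc k) o {y} (o<y , y≤) =
  subst (y ∈_) (sym eq) (find (y ℕ.≤? n + o) (y ℕ.≤? s) (y ℕ.≤? z) (y ℕ.≤? p))
  where
  open Gadget k o
  eq : Infix.toList (greedyTree (suc k) o) ≡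
       Infix.toList (greedyTree k o) ++ s ∷ z ∷ p ∷ Infix.toList (greedyTree k p)
  eq = infix-diff (greedyTree k o) _

  find : Dec (y ≤ n + o) → Dec (y ≤ s) → Dec (y ≤ z) → Dec (y ≤ p) →
         y ∈ Infix.toList (greedyTree k o) ++ s ∷ z ∷ p ∷ Infix.toList (greedyTree k p)
  find (yes y≤) _ _ _ = ∈-++⁺ˡ (greedyTree-complete k o (o<y , y≤))
  find (no y≰) (yes y≤s) _ _ = ∈-++⁺ʳ _ (here (ℕ.≤-antisym y≤s (ℕ.≰⇒> y≰)))
  find _ (no y≰) (yes y≤z) _ = ∈-++⁺ʳ _ (there (here (ℕ.≤-antisym y≤z (ℕ.≰⇒> y≰))))
  find _ _ (no y≰) (yes y≤p) = ∈-++⁺ʳ _ (there (there (here (ℕ.≤-antisym y≤p (ℕ.≰⇒> y≰)))))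
  find _ _ _ (no y≰) = ∈-++⁺ʳ _ (there (there (there
    (greedyTree-complete k p (ℕ.≰⇒> y≰ , subst (y ≤_) (sym top≡) y≤)))))

greedyTree-isBST : ∀ k → IsBST (size k) (greedyTree k 0)
greedyTree-isBST k = greedyTree-ordered k 0 , λ y → mk⇔
  (λ y∈ → subst (λ h → Within 0 h y) (ℕ.+-identityʳ (size k))
                (All.lookup (All⇒infix (greedyTree-within k 0)) y∈))
  (λ y∈ → greedyTree-complete k 0 (subst (λ h → Within 0 h y) (sym (ℕ.+-identityʳ (size k))) y∈))

queries-keys : ∀ k N → All (IsKey (size k)) (queries k 0 N)
queries-keys k N = All.map⁺ (All.universal
  (λ w → subst (λ h → Within 0 h (key k 0 w)) (ℕ.+-identityʳ (size k)) (key-within k 0 w)) _)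

-- Heap order of every search path, by induction on the level

module _ (k o : ℕ) where
  open Gadget k o

  private
    A B AB : BinTree
    A = greedyTree k o
    B = greedyTree k p
    AB = greedyTree (suc k) o

    a<s : ∀ w → key k o w < s
    a<s w = s≤s (proj₂ (key-within k o w))

    a<p : ∀ w → key k o w < p
    a<p w = ℕ.<-trans (a<s w) s<p

    p<b : ∀ w → p < key k p w
    p<b w = proj₁ (key-within k p w)

    irr : ∀ {C : Set} {u} → u < u → C
    irr u<u = contradiction refl (ℕ.<⇒≢ u<u)

    above : ∀ {C : Set} {u v} → u < v → v < u → C
    above u<v v<u = contradiction u<v (ℕ.<-asym v<u)

  pathTop-centre : pathTop z AB ≡ node (node (leaf A) s (node (leaf (leaf tt)) z (leaf (leaf tt)))) p (leaf B)
  pathTop-centre = trans (pathTop-< z<p) (cong (λ t → node t p (leaf B))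
    (trans (pathTop-> s<z) (cong (node (leaf A) s) (pathTop-≡ {z}))))

  pathTop-right : ∀ w → pathTop (key k p w) AB ≡ node (leaf _) p (pathTop (key k p w) B)
  pathTop-right w = pathTop-> (p<b w)

  pathTop-left : ∀ w → pathTop (key k o w) AB ≡
                 node (node (pathTop (key k o w) A) s (leaf _)) p (leaf B)
  pathTop-left w = trans (pathTop-< (a<p w)) (cong (λ t → node t p (leaf B)) (pathTop-< (a<s w)))

  -- Expansion puts `z` before and a query to the left copy after each query to the right copy. Both
  -- are misses for `Q′`, so the order of first hits is unaffected.
  lead-right : ∀ {P P′ Q Q′ : Pred ℕ 0ℓ} →
               (∀ w → P (key k p w) → P′ (key k p w)) → (∀ w → Q′ (key k p w) → Q (key k p w)) →
               ¬ Q′ z → (∀ w → ¬ Q′ (key k o w)) →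
               ∀ ws → Lead P Q (map (key k p) ws) → Lead P′ Q′ (map (key (suc k) o) (expand ws))
  lead-right f g ¬z ¬a []       _           = []
  lead-right f g ¬z ¬a (w ∷ ws) (hit x)     = miss ¬z (hit (f w x))
  lead-right f g ¬z ¬a (w ∷ ws) (miss ¬q l) =
    miss ¬z (miss (¬q ∘ g w) (miss (¬a w) (lead-right f g ¬z ¬a ws l)))

  lead-left : ∀ {P P′ Q Q′ : Pred ℕ 0ℓ} →
              (∀ w → P (key k o w) → P′ (key k o w)) → (∀ w → Q′ (key k o w) → Q (key k o w)) →
              ¬ Q′ z → (∀ w → ¬ Q′ (key k p w)) →
              ∀ ws → Lead P Q (map (key k o) ws) → Lead P′ Q′ (map (key (suc k) o) (expand ws))
  lead-left f g ¬z ¬b []       _           = []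
  lead-left f g ¬z ¬b (w ∷ ws) (hit x)     = miss ¬z (miss (¬b w) (hit (f w x)))
  lead-left f g ¬z ¬b (w ∷ ws) (miss ¬q l) =
    miss ¬z (miss (¬b w) (miss (¬q ∘ g w) (lead-left f g ¬z ¬b ws l)))

  -- The order of a round is made for this path. The next query, in the right copy, lies only in the
  -- gap of `p`; the one after it, in the left copy, only in the gap of `s`; the gap of `z` is
  -- missed by both.
  heap-centre : ∀ w future → PathHeap AB z (key k p w ∷ key k o w ∷ future)
  heap-centre w F = subst (LeadHeap (key k p w ∷ key k o w ∷ F)) (sym pathTop-centre)
    (node (Tree.node (Tree.leaf tt) (hit gap-p) (Tree.node (Tree.leaf tt) (hit gap-p) (Tree.leaf tt)))
          (Tree.leaf tt)
          (node (Tree.leaf tt)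
                (Tree.node (Tree.leaf tt) (miss ¬gap-z (hit gap-s)) (Tree.leaf tt))
                leaf
                (node (Tree.leaf tt) (Tree.leaf tt) leaf leaf))
          leaf)
    where
    vs = s ∷ z ∷ p ∷ []

    gap-p : Gap vs p (key k p w)
    gap-p = ((λ _ → ℕ.<-trans s<p (p<b w)) , above s<p)
          ∷ ((λ _ → ℕ.<-trans z<p (p<b w)) , above z<p)
          ∷ (irr , irr) ∷ []

    ¬gap-z : ¬ Gap vs z (key k p w)
    ¬gap-z (_ ∷ _ ∷ (_ , h) ∷ []) = above (p<b w) (h z<p)

    gap-s : Gap vs s (key k o w)
    gap-s = (irr , irr)
          ∷ (above s<z , λ _ → ℕ.<-trans (a<s w) s<z)
          ∷ (above s<p , λ _ → a<p w) ∷ []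

  -- The next query is to the left copy, hence in the gap of `p`. The gap of the least inner key was
  -- unbounded below within the copy alone; now `p` bounds it, so that `z` and the left copy stay
  -- outside.
  heap-right : ∀ w ws → PathHeap B (key k p w) (map (key k p) ws) →
               PathHeap AB (key k p w) (key k o w ∷ map (key (suc k) o) (expand ws))
  heap-right w ws h = subst (LeadHeap _) (sym (pathTop-right w))
    (node (Tree.leaf tt) (Tree.mapₙ (λ _ → hit gap-p) above-p) leaf
          (Heap-map inner above-p h))
    where
    vs = Infix.toList (pathTop (key k p w) B)

    above-p : Tree.All (p <_) U (pathTop (key k p w) B)
    above-p = All-pathTop (key k p w) (Tree.mapₙ proj₁ (greedyTree-within k p))

    gap-p : Gap (p ∷ vs) p (key k o w)
    gap-p = (irr , irr) ∷ All.map (λ p<v → above p<v , λ _ → ℕ.<-trans (a<p w) p<v) (All⇒infix above-p)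

    inner : ∀ {u v} → p < u → p < v → Leads (map (key k p) ws) vs u v →
            Leads (key k o w ∷ map (key (suc k) o) (expand ws)) (p ∷ vs) u v
    -- The current round still owes its query to the left copy; only after it do whole rounds
    -- follow.
    inner {u} {v} p<u p<v l = miss (¬low (a<p w))
      (lead-right (λ w′ g → ((λ _ → p<b w′) , above p<u) ∷ g) (λ _ → All.tail)
                  (¬low z<p) (λ w′ → ¬low (a<p w′)) ws l)
      where
      ¬low : ∀ {y} → y < p → ¬ Gap (p ∷ vs) v y
      ¬low y<p (g ∷ _) = above y<p (proj₁ g p<v)

  -- The round is complete and `z` comes next. It lies beyond `s` and below `p`, hence in the gaps
  -- of both, while `s` now bounds the inner gaps on the right. The tie between `p` and `s` is left
  -- to depth.
  heap-left : ∀ w ws → PathHeap A (key k o w) (map (key k o) ws) →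
              PathHeap AB (key k o w) (map (key (suc k) o) (expand ws))
  heap-left w ws h = subst (LeadHeap _) (sym (pathTop-left w))
    (subst (λ vs → Heap (Leads _ vs) (node (node S s (leaf C)) p (leaf B)))
      (sym (infix-diff S (s ∷ p ∷ [])))
      (node (Tree.node (Tree.mapₙ (λ _ → now gap-p ws) below-s) (now gap-p ws) (Tree.leaf tt))
            (Tree.leaf tt)
            (node (Tree.mapₙ (λ _ → now gap-s ws) below-s) (Tree.leaf tt)
                  (Heap-map inner below-s h) leaf)
            leaf))
    where
    S = pathTop (key k o w) A
    C = node (leaf tt) z (leaf tt)
    vs = Infix.toList S

    below-s : Tree.All (_< s) U S
    below-s = All-pathTop (key k o w) (Tree.mapₙ (s≤s ∘ proj₂) (greedyTree-within k o))

    -- After the last round the future is empty and all times are infinite, so the comparison holds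
    -- there too.
    now : ∀ {P Q : Pred ℕ 0ℓ} → P z → ∀ ws → Lead P Q (map (key (suc k) o) (expand ws))
    now pz []      = []
    now pz (_ ∷ _) = hit pz

    gap-p : Gap (vs ++ s ∷ p ∷ []) p z
    gap-p = All.++⁺ (All.map (λ v<s → (λ _ → ℕ.<-trans v<s s<z) , above (ℕ.<-trans v<s s<p)) (All⇒infix below-s))
                    (((λ _ → s<z) , above s<p) ∷ (irr , irr) ∷ [])

    gap-s : Gap (vs ++ s ∷ p ∷ []) s z
    gap-s = All.++⁺ (All.map (λ v<s → (λ _ → ℕ.<-trans v<s s<z) , above v<s) (All⇒infix below-s))
                    ((irr , irr) ∷ (above s<p , λ _ → z<p) ∷ [])

    inner : ∀ {u v} → u < s → v < s → Leads (map (key k o) ws) vs u v →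
            Leads (map (key (suc k) o) (expand ws)) (vs ++ s ∷ p ∷ []) u v
    inner {u} {v} u<s v<s l = lead-left
      (λ w′ g → All.++⁺ g ((above u<s , λ _ → a<s w′) ∷ (above (ℕ.<-trans u<s s<p) , λ _ → a<p w′) ∷ []))
      (λ _ → All.++⁻ˡ vs)
      (¬high s<z) (λ w′ → ¬high (ℕ.<-trans s<p (p<b w′))) ws l
      where
      ¬high : ∀ {y} → s < y → ¬ Gap (vs ++ s ∷ p ∷ []) v y
      ¬high s<y g with (_ , h) ∷ _ ← All.++⁻ʳ vs g = above s<y (h v<s)

  heaps-expand : ∀ ws → PathHeaps A (map (key k o) ws) → PathHeaps B (map (key k p) ws) →
                 PathHeaps AB (map (key (suc k) o) (expand ws))
  heaps-expand []       _         _         = tt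
  heaps-expand (w ∷ ws) (ha , as) (hb , bs) =
    heap-centre w _ , heap-right w ws hb , heap-left w ws ha , heaps-expand ws as bs

greedyTree-heaps : ∀ k o N → PathHeaps (greedyTree k o) (queries k o N)
greedyTree-heaps zero    o zero    = tt
greedyTree-heaps zero    o (suc N) =
  subst (LeadHeap _) (sym (pathTop-≡ {suc o}))
        (node (Tree.leaf tt) (Tree.leaf tt) leaf leaf)
  , greedyTree-heaps zero o N
greedyTree-heaps (suc k) o N =
  heaps-expand k o (word k N) (greedyTree-heaps k o N) (greedyTree-heaps k (sep₂ k o) N)

-- The cheap static tree and the total costs

-- The separators are never queried, so they may hang below the recursive copies.
optTree : (k o : ℕ) (l r : BinTree) → BinTree
optTree zero    o l r = node l (suc o) r
optTree (suc k) o l r =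
  node (optTree k o l (node (leaf tt) (sep₁ k o) (leaf tt)))
       (centreKey k o)
       (optTree k (sep₂ k o) (node (leaf tt) (sep₂ k o) (leaf tt)) r)

optTree-infix : ∀ k o l r xs → Infix.toDiffList (optTree k o l r) xs ≡
                Infix.toDiffList l (Infix.toDiffList (greedyTree k o) (Infix.toDiffList r xs))
optTree-infix zero    o l r xs = refl
optTree-infix (suc k) o l r xs = trans
  (optTree-infix k o l _ _)
  (cong (λ ys → Infix.toDiffList l (Infix.toDiffList (greedyTree k o) (sep₁ k o ∷ centreKey k o ∷ ys)))
        (optTree-infix k (sep₂ k o) _ r xs))

greedyDepth optDepth : ∀ {k} → Address k → ℕ
greedyDepth only    = 1
greedyDepth centre  = 3
greedyDepth (inˡ w) = 2 + greedyDepth w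
greedyDepth (inʳ w) = 1 + greedyDepth w
optDepth only    = 1
optDepth centre  = 1
optDepth (inˡ w) = 1 + optDepth w
optDepth (inʳ w) = 1 + optDepth w

depth-greedyTree : ∀ k o w → depth (key k o w) (greedyTree k o) ≡ greedyDepth w
depth-greedyTree zero    o only    = depth-root (suc o)
depth-greedyTree (suc k) o centre  = begin
  depth z (greedyTree (suc k) o)             ≡⟨ cong length (path-< z<p) ⟩
  1 + depth z (node A s (node _ z _))        ≡⟨ cong (suc ∘ length) (path-> s<z) ⟩
  2 + depth z (node (leaf tt) z (leaf tt))   ≡⟨ cong (λ t → 2 + t) (depth-root z) ⟩
  3                                          ∎
  where
  open Gadget k o
  open ≡-Reasoning
  A = greedyTree k o
depth-greedyTree (suc k) o (inˡ w) = trans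
  (cong length (path-< (ℕ.<-trans w<s s<p)))
  (cong suc (trans (cong length (path-< w<s)) (cong suc (depth-greedyTree k o w))))
  where
  open Gadget k o
  w<s = s≤s (proj₂ (key-within k o w))
depth-greedyTree (suc k) o (inʳ w) = trans
  (cong length (path-> (proj₁ (key-within k p w))))
  (cong suc (depth-greedyTree k p w))
  where open Gadget k o

depth-optTree : ∀ k o l r w → depth (key k o w) (optTree k o l r) ≡ optDepth w
depth-optTree zero    o l r only    = depth-root (suc o)
depth-optTree (suc k) o l r centre  = depth-root (centreKey k o)
depth-optTree (suc k) o l r (inˡ w) = trans
  (cong length (path-< (ℕ.<-trans (s≤s (proj₂ (key-within k o w))) s<z)))
  (cong suc (depth-optTree k o _ _ w))
  where open Gadget k o
depth-optTree (suc k) o l r (inʳ w) = trans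
  (cong length (path-> (ℕ.<-trans z<p (proj₁ (key-within k p w)))))
  (cong suc (depth-optTree k p _ _ w))
  where open Gadget k o

length-word : ∀ k N → length (word k N) ≡ 3 ^ k * N
length-word zero    N = trans (List.length-replicate N) (sym (ℕ.*-identityˡ N))
length-word (suc k) N = trans (length-expand (word k N))
  (trans (cong (3 *_) (length-word k N)) (sym (ℕ.*-assoc 3 (3 ^ k) N)))
  where
  length-expand : ∀ (ws : List (Address k)) → length (expand ws) ≡ 3 * length ws
  length-expand []       = refl
  length-expand (w ∷ ws) = trans (cong (λ t → 3 + t) (length-expand ws)) (sym (ℕ.*-suc 3 (length ws)))

sum-greedyDepth-expand : ∀ {k} (ws : List (Address k)) →
  sum (map greedyDepth (expand ws)) ≡ 6 * length ws + 2 * sum (map greedyDepth ws)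
sum-greedyDepth-expand []       = refl
sum-greedyDepth-expand (w ∷ ws) = trans
  (cong (λ t → 3 + (1 + greedyDepth w + (2 + greedyDepth w + t))) (sum-greedyDepth-expand ws))
  (regroup (greedyDepth w) (length ws) (sum (map greedyDepth ws)))
  where
  regroup : ∀ d n t → 3 + (1 + d + (2 + d + (6 * n + 2 * t))) ≡ 6 * suc n + 2 * (d + t)
  regroup = ℕ-Ring.solve-∀

sum-optDepth-expand : ∀ {k} (ws : List (Address k)) →
  sum (map optDepth (expand ws)) ≡ 3 * length ws + 2 * sum (map optDepth ws)
sum-optDepth-expand []       = refl
sum-optDepth-expand (w ∷ ws) = trans
  (cong (λ t → 1 + (1 + optDepth w + (1 + optDepth w + t))) (sum-optDepth-expand ws))
  (regroup (optDepth w) (length ws) (sum (map optDepth ws)))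
  where
  regroup : ∀ d n t → 1 + (1 + d + (1 + d + (3 * n + 2 * t))) ≡ 3 * suc n + 2 * (d + t)
  regroup = ℕ-Ring.solve-∀

greedyTotal optTotal : ℕ → ℕ → ℕ
greedyTotal k N = sum (map greedyDepth (word k N))
optTotal    k N = sum (map optDepth (word k N))

-- A new level adds 6 and 3 per round to the two doubled totals. These cancel in twice the static
-- total minus the greedy one, so that this difference just doubles per level, starting from `N`.
greedyTotal-optTotal : ∀ k N → greedyTotal k N + 2 ^ k * N ≡ 2 * optTotal k N
greedyTotal-optTotal zero    zero    = refl
greedyTotal-optTotal zero    (suc N) = trans (collectˡ (greedyTotal 0 N) N)
  (trans (cong (λ t → 2 + t) (greedyTotal-optTotal zero N)) (sym (ℕ.*-suc 2 (optTotal 0 N))))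
  where
  collectˡ : ∀ g N → suc g + 1 * suc N ≡ 2 + (g + 1 * N)
  collectˡ = ℕ-Ring.solve-∀
greedyTotal-optTotal (suc k) N = begin
  greedyTotal (suc k) N + 2 * 2 ^ k * N       ≡⟨ cong (_+ 2 * 2 ^ k * N) (sum-greedyDepth-expand ws) ⟩
  6 * n + 2 * greedyTotal k N + 2 * 2 ^ k * N ≡⟨ collectˡ n (greedyTotal k N) (2 ^ k) N ⟩
  6 * n + 2 * (greedyTotal k N + 2 ^ k * N)   ≡⟨ cong (λ t → 6 * n + 2 * t) (greedyTotal-optTotal k N) ⟩
  6 * n + 2 * (2 * optTotal k N)              ≡⟨ collectʳ n (optTotal k N) ⟩
  2 * (3 * n + 2 * optTotal k N)              ≡⟨ cong (2 *_) (sum-optDepth-expand ws) ⟨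
  2 * optTotal (suc k) N                      ∎
  where
  open ≡-Reasoning
  ws = word k N
  n  = length ws
  collectˡ : ∀ n g e N → 6 * n + 2 * g + 2 * e * N ≡ 6 * n + 2 * (g + e * N)
  collectˡ = ℕ-Ring.solve-∀
  collectʳ : ∀ n t → 6 * n + 2 * (2 * t) ≡ 2 * (3 * n + 2 * t)
  collectʳ = ℕ-Ring.solve-∀

-- This solves the recurrence that doubles the total and adds three times the word length. The
-- negative term stands on the left to avoid truncated subtraction.
optTotal-closed : ∀ k N → optTotal k N + 2 * 2 ^ k * N ≡ 3 * 3 ^ k * N
optTotal-closed zero    zero    = refl
optTotal-closed zero    (suc N) = trans (collectˡ (optTotal 0 N) N)
  (trans (cong (λ t → 3 + t) (optTotal-closed zero N)) (sym (ℕ.*-suc 3 N)))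
  where
  collectˡ : ∀ t N → suc t + 2 * 1 * suc N ≡ 3 + (t + 2 * 1 * N)
  collectˡ = ℕ-Ring.solve-∀
optTotal-closed (suc k) N = begin
  optTotal (suc k) N + 2 * (2 * 2 ^ k) * N                 ≡⟨ cong (_+ 2 * (2 * 2 ^ k) * N) (sum-optDepth-expand (word k N)) ⟩
  3 * length (word k N) + 2 * optTotal k N + 2 * (2 * 2 ^ k) * N ≡⟨ cong (λ n → 3 * n + 2 * optTotal k N + 2 * (2 * 2 ^ k) * N) (length-word k N) ⟩
  3 * (3 ^ k * N) + 2 * optTotal k N + 2 * (2 * 2 ^ k) * N ≡⟨ collectˡ (3 ^ k) N (optTotal k N) (2 ^ k) ⟩
  3 * (3 ^ k * N) + 2 * (optTotal k N + 2 * 2 ^ k * N)     ≡⟨ cong (λ t → 3 * (3 ^ k * N) + 2 * t) (optTotal-closed k N) ⟩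
  3 * (3 ^ k * N) + 2 * (3 * 3 ^ k * N)                    ≡⟨ collectʳ (3 ^ k) N ⟩
  3 * (3 * 3 ^ k) * N                                      ∎
  where
  open ≡-Reasoning
  collectˡ : ∀ e N t f → 3 * (e * N) + 2 * t + 2 * (2 * f) * N ≡ 3 * (e * N) + 2 * (t + 2 * f * N)
  collectˡ = ℕ-Ring.solve-∀
  collectʳ : ∀ e N → 3 * (e * N) + 2 * (3 * e * N) ≡ 3 * (3 * e) * N
  collectʳ = ℕ-Ring.solve-∀

cost-static-≤ : ∀ T X → cost (static T X) ≤ sum (map (λ x → depth x T) X)
cost-static-≤ T []      = z≤n
cost-static-≤ T (x ∷ X) = ℕ.+-mono-≤
  (subst (λ xs → length (deduplicate ℕ._≟_ (path x T ++ [])) ≤ length xs)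
         (List.++-identityʳ (path x T)) (List.length-deduplicate ℕ._≟_ (path x T ++ [])))
  (cost-static-≤ T X)

-- Reaching the cheap tree by rotations

Rotatable : BinTree → BinTree → Set
Rotatable T T′ = ∃ λ es → T ⟶*[ es ] T′

_▷_ : T ⟶*[ es ] T′ → T′ ⟶*[ fs ] T″ → T ⟶*[ es ++ fs ] T″
[]       ▷ ss = ss
(s ∷ rs) ▷ ss = s ∷ (rs ▷ ss)

inˡ* : l ⟶*[ es ] l′ → node l k r ⟶*[ es ] node l′ k r
inˡ* []       = []
inˡ* (s ∷ ss) = inˡ s ∷ inˡ* ss

inʳ* : r ⟶*[ es ] r′ → node l k r ⟶*[ es ] node l k r′
inʳ* []       = []
inʳ* (s ∷ ss) = inʳ s ∷ inʳ* ss

unrotate : T ⟶[ ed ] T′ → T′ ⟶[ ed ] T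
unrotate rotʳ    = rotˡ
unrotate rotˡ    = rotʳ
unrotate (inˡ s) = inˡ (unrotate s)
unrotate (inʳ s) = inʳ (unrotate s)

Rotatable-sym : Rotatable T T′ → Rotatable T′ T
Rotatable-sym (_ , [])     = _ , []
Rotatable-sym (_ , s ∷ ss) = _ , proj₂ (Rotatable-sym (_ , ss)) ▷ (unrotate s ∷ [])

spine : List ℕ → BinTree
spine []       = leaf tt
spine (k ∷ ks) = node (leaf tt) k (spine ks)

-- Spines are normal forms determined by the infix list. As rotations are reversible, any two trees
-- with the same infix list are connected through their spine.
rotate-to-spine : ∀ T → Rotatable T (spine (Infix.toList T))
rotate-to-spine (leaf _)     = _ , []
rotate-to-spine (node l k r) = subst (λ ks → Rotatable (node l k r) (spine ks)) (sym (infix-node l k r))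
  (_ , inˡ* (proj₂ (rotate-to-spine l)) ▷ (inʳ* (proj₂ (rotate-to-spine r)) ▷ proj₂ (merge (Infix.toList l))))
  where
  merge : ∀ ks → Rotatable (node (spine ks) k (spine (Infix.toList r))) (spine (ks ++ k ∷ Infix.toList r))
  merge []       = _ , []
  -- Lifting the root of the left spine above `k` leaves the same problem, one key shorter, in the
  -- right subtree.
  merge (_ ∷ ks) = _ , rotʳ ∷ inʳ* (proj₂ (merge ks))

-- A route through such a tour involves every key, so its minimal subtree is the
-- whole tree.
spine-tour : ∀ ks → 2 ≤ length ks → ∃ λ es → spine ks ⟶*[ es ] spine ks × ks ⊆ endpoints es
spine-tour (_ ∷ [])             (s≤s ())
spine-tour (a ∷ b ∷ [])         _ = _ , rotˡ ∷ rotʳ ∷ [] , λ where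
  (here refl)         → here refl
  (there (here refl)) → there (here refl)
spine-tour (a ∷ b ∷ ks@(_ ∷ _)) _ with es , ss , cover ← spine-tour (b ∷ ks) (s≤s (s≤s z≤n)) =
  _ , rotˡ ∷ rotʳ ∷ inʳ* ss , λ where
    (here refl) → here refl
    (there x∈)  → there (there (there (there (cover x∈))))

rotation-infix : T ⟶[ ed ] T′ → ∀ xs → Infix.toDiffList T xs ≡ Infix.toDiffList T′ xs
rotation-infix rotʳ              xs = refl
rotation-infix rotˡ              xs = refl
rotation-infix (inˡ s)           xs = rotation-infix s _
rotation-infix (inʳ {l} {k} s)   xs = cong (λ ys → Infix.toDiffList l (k ∷ ys)) (rotation-infix s xs)

∈-toDiffList : ∀ (T : BinTree) {x xs} → x ∈ xs → x ∈ Infix.toDiffList T xs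
∈-toDiffList (leaf _)     x∈ = x∈
∈-toDiffList (node l k r) x∈ = ∈-toDiffList l (there (∈-toDiffList r x∈))

edge-keys : ∀ {u v} → T ⟶[ u , v ] T′ → ∀ xs → u ∈ Infix.toDiffList T xs × v ∈ Infix.toDiffList T xs
edge-keys (rotʳ {a} {u} {b} {v} {c}) xs =
  ∈-toDiffList a (here refl) , ∈-toDiffList a (there (∈-toDiffList b (here refl)))
edge-keys (rotˡ {a} {u} {b} {v} {c}) xs =
  ∈-toDiffList a (here refl) , ∈-toDiffList a (there (∈-toDiffList b (here refl)))
edge-keys (inˡ s)     xs = edge-keys s _
edge-keys (inʳ {l} s) xs with u∈ , v∈ ← edge-keys s xs =
  ∈-toDiffList l (there u∈) , ∈-toDiffList l (there v∈)

endpoints-⊆ : T ⟶*[ es ] T′ → endpoints es ⊆ Infix.toList T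
endpoints-⊆ (s ∷ ss) (here refl)         = proj₁ (edge-keys s [])
endpoints-⊆ (s ∷ ss) (there (here refl)) = proj₂ (edge-keys s [])
endpoints-⊆ (s ∷ ss) (there (there x∈))  = subst (_ ∈_) (sym (rotation-infix s [])) (endpoints-⊆ ss x∈)

whole : BinTree → Top
whole (leaf t)     = leaf (leaf t)
whole (node l k r) = node (whole l) k (whole r)

graft-whole : ∀ T → graft (whole T) ≡ T
graft-whole (leaf _)     = refl
graft-whole (node l k r) = cong₂ (λ l r → node l k r) (graft-whole l) (graft-whole r)

infix-whole : ∀ T xs → Infix.toDiffList T xs ≡ Infix.toDiffList (whole T) xs
infix-whole (leaf _)     xs = refl
infix-whole (node l k r) xs =
  trans (infix-whole l _) (cong (λ ys → Infix.toDiffList (whole l) (k ∷ ys)) (infix-whole r xs))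

endpoints-++ : ∀ es fs → endpoints (es ++ fs) ≡ endpoints es ++ endpoints fs
endpoints-++ []       fs = refl
endpoints-++ (e ∷ es) fs = cong (λ xs → _ ∷ _ ∷ xs) (endpoints-++ es fs)

-- The detour through the spine is affordable because a step is charged for nodes and not for
-- rotations.
rebuild : ∀ {x} T T′ → Infix.toList T ≡ Infix.toList T′ → 2 ≤ length (Infix.toList T) →
          Σ (Step T x T′) λ s → stepCost s ≤ length (path x T) + length (Infix.toList T)
rebuild {x} T T′ same 2≤
  with es , to     ← rotate-to-spine T
     | fs , tour , cover ← spine-tour (Infix.toList T) 2≤
     | gs , from   ← Rotatable-sym (rotate-to-spine T′)
  = step , subst (stepCost step ≤_) (List.length-++ (path x T))
                 (List.length-deduplicate ℕ._≟_ (path x T ++ Infix.toList T))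
  where
  route : T ⟶*[ es ++ fs ++ gs ] T′
  route = to ▷ (tour ▷ subst (λ ks → spine ks ⟶*[ gs ] T′) (sym same) from)

  all-touched : Infix.toList T ⊆ endpoints (es ++ fs ++ gs)
  all-touched x∈ = subst (_ ∈_) (sym (endpoints-++ es (fs ++ gs)))
    (∈-++⁺ʳ (endpoints es) (subst (_ ∈_) (sym (endpoints-++ fs gs)) (∈-++⁺ˡ (cover x∈))))

  step : Step T x T′
  step = record
    { edges     = es ++ fs ++ gs
    ; rotations = route
    ; touched   = Infix.toList T
    ; minimal   = (whole T , subst (_⊑ T) (sym (graft-whole T)) here , infix-whole T [])
                , endpoints-⊆ route
                , λ _ _ sub → sub ∘ all-touched
    }

length-path-≤ : ∀ x T → length (path x T) ≤ #nodes T
length-path-≤ x (leaf _)     = z≤n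
length-path-≤ x (node l k r) with ℕ.<-cmp x k
... | tri< _ _ _ = ℕ.≤-trans (s≤s (ℕ.≤-trans (length-path-≤ x l) (ℕ.m≤m+n (#nodes l) (#nodes r))))
                             (ℕ.≤-reflexive (sym (ℕ.+-suc (#nodes l) (#nodes r))))
... | tri≈ _ _ _ = ℕ.≤-trans (s≤s z≤n) (ℕ.m≤n+m (suc (#nodes r)) (#nodes l))
... | tri> _ _ _ = ℕ.≤-trans (s≤s (length-path-≤ x r)) (ℕ.m≤n+m (suc (#nodes r)) (#nodes l))

rebuild-then-static : ∀ T T′ X → Infix.toList T ≡ Infix.toList T′ → 2 ≤ length (Infix.toList T) →
  Σ (Run T X) λ run → cost run ≤ #nodes T + length (Infix.toList T) + sum (map (λ x → depth x T′) X)
rebuild-then-static T T′ []      _    _  = [] , z≤n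
rebuild-then-static T T′ (x ∷ X) same 2≤ with s , s≤ ← rebuild T T′ same 2≤ =
  s ∷ static T′ X
  , ℕ.+-mono-≤ (ℕ.≤-trans s≤ (ℕ.+-monoˡ-≤ _ (length-path-≤ x T)))
               -- The depth of `x` in `T′` is added as slack, so that the bound sums over the whole
               -- sequence.
               (ℕ.≤-trans (cost-static-≤ T′ X) (ℕ.m≤n+m _ _))

-- The greedy run, the cheap run and the existence of an optimal run

sum-depth : ∀ k o T (d : Address k → ℕ) → (∀ w → depth (key k o w) T ≡ d w) → ∀ ws →
            sum (map (λ x → depth x T) (map (key k o) ws)) ≡ sum (map d ws)
sum-depth k o T d eq []       = refl
sum-depth k o T d eq (w ∷ ws) = cong₂ _+_ (eq w) (sum-depth k o T d eq ws)

greedyRun : ∀ k N → Run (greedyTree k 0) (queries k 0 N)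
greedyRun k N = static (greedyTree k 0) (queries k 0 N)

greedyRun-greedy : ∀ k N → IsGreedy (greedyRun k N)
greedyRun-greedy k N =
  static-greedy (greedyTree-ordered k 0) (queries k 0 N) (greedyTree-heaps k 0 N)

greedyRun-cost : ∀ k N → cost (greedyRun k N) ≡ greedyTotal k N
greedyRun-cost k N = trans (cost-static (greedyTree-ordered k 0) (queries k 0 N))
  (sum-depth k 0 (greedyTree k 0) greedyDepth (depth-greedyTree k 0) (word k N))

setup : ℕ → ℕ
setup k = #nodes (greedyTree k 0) + length (Infix.toList (greedyTree k 0))

-- At level zero there is one key and no edge to rotate, hence `suc k`.
cheapRun : ∀ k N → Σ (Run (greedyTree (suc k) 0) (queries (suc k) 0 N)) λ run →
           cost run ≤ setup (suc k) + optTotal (suc k) N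
cheapRun k N = subst (λ t → Σ (Run G (queries (suc k) 0 N)) λ run → cost run ≤ setup (suc k) + t)
  (sum-depth (suc k) 0 Q optDepth (depth-optTree (suc k) 0 _ _) (word (suc k) N))
  (rebuild-then-static G Q (queries (suc k) 0 N) (sym (optTree-infix (suc k) 0 _ _ [])) two)
  where
  G Q : BinTree
  G = greedyTree (suc k) 0
  Q = optTree (suc k) 0 (leaf tt) (leaf tt)
  two : 2 ≤ length (Infix.toList G)
  two = subst (λ xs → 2 ≤ length xs) (sym (infix-diff (greedyTree k 0) _))
    (subst (2 ≤_) (sym (List.length-++ (Infix.toList (greedyTree k 0))))
      (ℕ.≤-trans (s≤s (s≤s z≤n)) (ℕ.m≤n+m _ (length (Infix.toList (greedyTree k 0))))))

-- Without an optimal run every run would be beaten by a cheaper one, and costs cannot descend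
-- forever. This yields no minimiser constructively, but a double negation suffices for deriving a
-- contradiction.
optimal-exists : ∀ {T X} → Run T X → ¬ ¬ (Σ (Run T X) IsOptimal)
optimal-exists {T} {X} r none = descend (suc (cost r)) r ℕ.≤-refl
  where
  descend : ∀ b (r : Run T X) → cost r < b → ⊥
  descend (suc b) r (s≤s r≤b) =
    none (r , λ r′ → ℕ.≮⇒≥ λ r′<r → descend b r′ (ℕ.<-≤-trans r′<r r≤b))

-- Natural numbers inside the rationals

ι : ℕ → ℚ
ι n = + n / 1

toℚᵘ-ι : ∀ n → toℚᵘ (ι n) ℚᵘ.≃ mkℚᵘ (+ n) 0
toℚᵘ-ι n = ℚ.toℚᵘ-fromℚᵘ (mkℚᵘ (+ n) 0)

ι-+ : ∀ m n → ι (m + n) ≡ ι m ℚ.+ ι n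
ι-+ m n = ℚ.toℚᵘ-injective (begin
  toℚᵘ (ι (m + n))                    ≈⟨ toℚᵘ-ι (m + n) ⟩
  mkℚᵘ (+ (m + n)) 0                  ≈⟨ *≡* (cong (ℤ._* + 1) (cong₂ ℤ._+_ (ℤ.*-identityʳ (+ m)) (ℤ.*-identityʳ (+ n)))) ⟨
  mkℚᵘ (+ m) 0 ℚᵘ.+ mkℚᵘ (+ n) 0      ≈⟨ ℚᵘ.+-cong (toℚᵘ-ι m) (toℚᵘ-ι n) ⟨
  toℚᵘ (ι m) ℚᵘ.+ toℚᵘ (ι n)          ≈⟨ ℚ.toℚᵘ-homo-+ (ι m) (ι n) ⟨
  toℚᵘ (ι m ℚ.+ ι n)                  ∎)
  where open SetoidReasoning ℚᵘ.≃-setoid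

ι-* : ∀ m n → ι (m * n) ≡ ι m ℚ.* ι n
ι-* m n = ℚ.toℚᵘ-injective (begin
  toℚᵘ (ι (m * n))                    ≈⟨ toℚᵘ-ι (m * n) ⟩
  mkℚᵘ (+ (m * n)) 0                  ≈⟨ *≡* (cong (ℤ._* + 1) (ℤ.pos-* m n)) ⟩
  mkℚᵘ (+ m) 0 ℚᵘ.* mkℚᵘ (+ n) 0      ≈⟨ ℚᵘ.*-cong (toℚᵘ-ι m) (toℚᵘ-ι n) ⟨
  toℚᵘ (ι m) ℚᵘ.* toℚᵘ (ι n)          ≈⟨ ℚ.toℚᵘ-homo-* (ι m) (ι n) ⟨
  toℚᵘ (ι m ℚ.* ι n)                  ∎)
  where open SetoidReasoning ℚᵘ.≃-setoid

ι-cancel-≤ : ∀ {m n} → ι m ℚ.≤ ι n → m ≤ n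
ι-cancel-≤ {m} {n} le with ℚᵘ.≤-respˡ-≃ (toℚᵘ-ι m) (ℚᵘ.≤-respʳ-≃ (toℚᵘ-ι n) (ℚ.toℚᵘ-mono-≤ le))
... | *≤* m≤n = ℤ.drop‿+≤+ (subst₂ ℤ._≤_ (ℤ.*-identityʳ (+ m)) (ℤ.*-identityʳ (+ n)) m≤n)

ι-nonNeg : ∀ n → ℚ.NonNegative (ι n)
ι-nonNeg n = ℚ.normalize-nonNeg n 1

ι-*-monoʳ-≤ : ∀ n {p q} → p ℚ.≤ q → ι n ℚ.* p ℚ.≤ ι n ℚ.* q
ι-*-monoʳ-≤ n = ℚ.*-monoˡ-≤-nonNeg (ι n) {{ι-nonNeg n}}

ι-reciprocal : ∀ m → ι (suc m) ℚ.* (+ 1 / suc m) ≡ 1ℚ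
ι-reciprocal m = ℚ.toℚᵘ-injective (begin
  toℚᵘ (ι (suc m) ℚ.* (+ 1 / suc m))          ≈⟨ ℚ.toℚᵘ-homo-* (ι (suc m)) (+ 1 / suc m) ⟩
  toℚᵘ (ι (suc m)) ℚᵘ.* toℚᵘ (+ 1 / suc m)    ≈⟨ ℚᵘ.*-cong (toℚᵘ-ι (suc m)) (ℚ.toℚᵘ-fromℚᵘ (mkℚᵘ (+ 1) m)) ⟩
  mkℚᵘ (+ suc m) 0 ℚᵘ.* mkℚᵘ (+ 1) m          ≈⟨ *≡* (cong +_ (units m)) ⟩
  toℚᵘ 1ℚ                                     ∎)
  where
  open SetoidReasoning ℚᵘ.≃-setoid
  units : ∀ m → suc m * 1 * 1 ≡ 1 * (1 * suc m)
  units = ℕ-Ring.solve-∀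

-- The denominator of `q` is a suitable multiplier: the product is the numerator, which is at least
-- 1.
archimedes : ∀ q → 0ℚ ℚ.< q → ∃ λ D → 1ℚ ℚ.≤ ι (suc D) ℚ.* q
archimedes (mkℚ (+ zero) _ _)          (*<* (ℤ.+<+ ()))
archimedes q@(mkℚ (+ suc n) D _) _ = D , ℚ.toℚᵘ-cancel-≤
  (ℚᵘ.≤-respʳ-≃ (ℚᵘ.≃-sym (ℚᵘ.≃-trans (ℚ.toℚᵘ-homo-* (ι (suc D)) q) (ℚᵘ.*-congʳ (toℚᵘ-ι (suc D)))))
    (*≤* (ℤ.+≤+ (subst₂ _≤_ (expandˡ D) (expandʳ D n) (ℕ.m≤m+n (suc D) (n * suc D))))))
  where
  expandˡ : ∀ D → suc D ≡ 1 * (1 * suc D)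
  expandˡ = ℕ-Ring.solve-∀
  expandʳ : ∀ D n → suc D + n * suc D ≡ suc D * suc n * 1
  expandʳ = ℕ-Ring.solve-∀

-- Estimates for a fixed level

-- Taking the `2 * 2 ^ k` of the closed form from both sides shows that the static cost per unit of
-- `N` is at least `(k + 1) * 2 ^ k`. Greedy Future thus pays at least 2 - 1/(k+1) times the static
-- cost, which beats an assumed 2 - 1/k.
powers : ∀ k → (k + 3) * 2 ^ k ≤ 3 * 3 ^ k
powers zero    = ℕ.≤-refl
powers (suc k) = begin
  (suc k + 3) * (2 * 2 ^ k)                        ≤⟨ ℕ.m≤m+n _ ((k + 1) * 2 ^ k) ⟩
  (suc k + 3) * (2 * 2 ^ k) + (k + 1) * 2 ^ k      ≡⟨ expandˡ k (2 ^ k) ⟩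
  3 * ((k + 3) * 2 ^ k)                            ≤⟨ ℕ.*-monoʳ-≤ 3 (powers k) ⟩
  3 * (3 * 3 ^ k)                                  ∎
  where
  open ℕ.≤-Reasoning
  expandˡ : ∀ k e → (suc k + 3) * (2 * e) + (k + 1) * e ≡ 3 * ((k + 3) * e)
  expandˡ = ℕ-Ring.solve-∀

-- Here G, T and O are the costs of Greedy Future, of the static tree and of OPT,
-- K is the cost of the initial restructuring, E = 2 ^ suc D and F = 3 ^ suc D.
rounds-bounded : ∀ D K T G E F O N →
  G + E * N ≡ 2 * T → T + 2 * E * N ≡ 3 * F * N → (suc D + 3) * E ≤ 3 * F → 1 ≤ E →
  O ≤ K + T → 2 * suc D * G + 2 * O ≤ 2 * O * (2 * suc D) + N + 2 * suc D →
  N ≤ (4 * D + 2) * K + 2 * suc D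
rounds-bounded D K T G E F O N G+EN≡2T T+2EN≡3FN powers 1≤E O≤K+T h =
  -- Write k for `suc D`. In essence kG is at most (2k-1)O + N/2 + k, and the remaining hypotheses
  -- turn this into EN at most (2k-1)K + N/2 + k. Since E is at least 1, half of N stays bounded;
  -- the claim is the double of this.
  ℕ.+-cancelˡ-≤ ((2 * suc D + 4) * E * N + N) _ _ (begin
    (2 * suc D + 4) * E * N + N + N
      ≤⟨ ℕ.+-mono-≤ (ℕ.+-monoʳ-≤ ((2 * suc D + 4) * E * N) N≤EN) N≤EN ⟩
    (2 * suc D + 4) * E * N + E * N + E * N
      ≡⟨ collect D E N ⟩
    2 * ((suc D + 3) * E * N)
      ≤⟨ ℕ.*-monoʳ-≤ 2 (ℕ.*-monoˡ-≤ N powers) ⟩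
    2 * (3 * F * N)
      ≡⟨ cong (2 *_) T+2EN≡3FN ⟨
    2 * (T + 2 * E * N)
      ≡⟨ ℕ.*-distribˡ-+ 2 T (2 * E * N) ⟩
    2 * T + 2 * (2 * E * N)
      ≤⟨ ℕ.+-monoˡ-≤ (2 * (2 * E * N)) 2T≤ ⟩
    (4 * D + 2) * K + (N + 2 * suc D) + 2 * suc D * (E * N) + 2 * (2 * E * N)
      ≡⟨ separate D K E N ⟩
    (2 * suc D + 4) * E * N + N + ((4 * D + 2) * K + 2 * suc D) ∎)
  where
  open ℕ.≤-Reasoning

  N≤EN : N ≤ E * N
  N≤EN = subst (_≤ E * N) (ℕ.*-identityˡ N) (ℕ.*-monoˡ-≤ N 1≤E)

  collect : ∀ D E N → (2 * suc D + 4) * E * N + E * N + E * N ≡ 2 * ((suc D + 3) * E * N)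
  collect = ℕ-Ring.solve-∀

  separate : ∀ D K E N →
    (4 * D + 2) * K + (N + 2 * suc D) + 2 * suc D * (E * N) + 2 * (2 * E * N) ≡
    (2 * suc D + 4) * E * N + N + ((4 * D + 2) * K + 2 * suc D)
  separate = ℕ-Ring.solve-∀

  greedy≤ : 2 * suc D * G ≤ (4 * D + 2) * (K + T) + (N + 2 * suc D)
  greedy≤ = ℕ.≤-trans
    -- The coefficient `4 * D + 2` is `2 * suc D` times 2 - 1/(D+1).
    (ℕ.+-cancelʳ-≤ (2 * O) _ _ (ℕ.≤-trans h (ℕ.≤-reflexive (split D O N))))
    (ℕ.+-monoˡ-≤ (N + 2 * suc D) (ℕ.*-monoʳ-≤ (4 * D + 2) O≤K+T))
    where
    split : ∀ D O N → 2 * O * (2 * suc D) + N + 2 * suc D ≡ (4 * D + 2) * O + (N + 2 * suc D) + 2 * O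
    split = ℕ-Ring.solve-∀

  2T≤ : 2 * T ≤ (4 * D + 2) * K + (N + 2 * suc D) + 2 * suc D * (E * N)
  2T≤ = ℕ.+-cancelˡ-≤ ((4 * D + 2) * T) _ _ (begin
    (4 * D + 2) * T + 2 * T
      ≡⟨ double D T ⟩
    2 * suc D * (2 * T)
      ≡⟨ cong (2 * suc D *_) G+EN≡2T ⟨
    2 * suc D * (G + E * N)
      ≡⟨ ℕ.*-distribˡ-+ (2 * suc D) G (E * N) ⟩
    2 * suc D * G + 2 * suc D * (E * N)
      ≤⟨ ℕ.+-monoˡ-≤ _ greedy≤ ⟩
    (4 * D + 2) * (K + T) + (N + 2 * suc D) + 2 * suc D * (E * N)
      ≡⟨ regroup D K T E N ⟩
    (4 * D + 2) * T + ((4 * D + 2) * K + (N + 2 * suc D) + 2 * suc D * (E * N)) ∎)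
    where
    double : ∀ D T → (4 * D + 2) * T + 2 * T ≡ 2 * suc D * (2 * T)
    double = ℕ-Ring.solve-∀
    regroup : ∀ D K T E N →
      (4 * D + 2) * (K + T) + (N + 2 * suc D) + 2 * suc D * (E * N) ≡
      (4 * D + 2) * T + ((4 * D + 2) * K + (N + 2 * suc D) + 2 * suc D * (E * N))
    regroup = ℕ-Ring.solve-∀

-- The second hypothesis says that q is at most 2 - 1/(D+1), and η is 1/(4(D+1)F), so the bound on d
-- equals N/(2(D+1)). Multiplying by 2(D+1) makes all terms integral, and `2 * O` is moved to the
-- left instead of being subtracted.
clear-denominators : ∀ D F N G O (c q d η : ℚ) →
  c ℚ.≤ q → ι (suc D) ℚ.* q ℚ.+ 1ℚ ℚ.≤ ι (2 * suc D) →
  ι G ℚ.≤ ι O ℚ.* c ℚ.+ d ℚ.+ 1ℚ →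
  ι (4 * suc D * F) ℚ.* η ≡ 1ℚ → d ℚ.≤ ι (F * N) ℚ.* (η ℚ.+ η) →
  2 * suc D * G + 2 * O ≤ 2 * O * (2 * suc D) + N + 2 * suc D
clear-denominators D F N G O c q d η c≤q Dq≤ G≤ η≡ d≤ = ι-cancel-≤ (begin
  ι (2 * suc D * G + 2 * O)
    ≡⟨ trans (ι-+ (2 * suc D * G) (2 * O)) (cong₂ ℚ._+_ (ι-* (2 * suc D) G) (ι-* 2 O)) ⟩
  u ℚ.* ι G ℚ.+ ι 2 ℚ.* ι O
    ≤⟨ ℚ.+-monoˡ-≤ (ι 2 ℚ.* ι O) (ι-*-monoʳ-≤ (2 * suc D) G≤) ⟩
  u ℚ.* (ι O ℚ.* c ℚ.+ d ℚ.+ 1ℚ) ℚ.+ ι 2 ℚ.* ι O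
    ≤⟨ ℚ.+-monoˡ-≤ (ι 2 ℚ.* ι O) (ι-*-monoʳ-≤ (2 * suc D)
         (ℚ.+-monoˡ-≤ 1ℚ (ℚ.+-mono-≤ (ι-*-monoʳ-≤ O c≤q) d≤))) ⟩
  u ℚ.* (ι O ℚ.* q ℚ.+ v ℚ.+ 1ℚ) ℚ.+ ι 2 ℚ.* ι O
    ≡⟨ cong (λ x → x ℚ.* (ι O ℚ.* q ℚ.+ v ℚ.+ 1ℚ) ℚ.+ ι 2 ℚ.* ι O) (ι-* 2 (suc D)) ⟩
  ι 2 ℚ.* ι (suc D) ℚ.* (ι O ℚ.* q ℚ.+ v ℚ.+ 1ℚ) ℚ.+ ι 2 ℚ.* ι O
    ≡⟨ regroup (ι 2) (ι (suc D)) (ι O) q v ⟩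
  ι 2 ℚ.* ι O ℚ.* (ι (suc D) ℚ.* q ℚ.+ 1ℚ) ℚ.+ ι 2 ℚ.* ι (suc D) ℚ.* v ℚ.+ ι 2 ℚ.* ι (suc D)
    ≡⟨ cong₂ (λ x y → x ℚ.* (ι (suc D) ℚ.* q ℚ.+ 1ℚ) ℚ.+ ι 2 ℚ.* ι (suc D) ℚ.* v ℚ.+ y)
             (ι-* 2 O) (ι-* 2 (suc D)) ⟨
  ι (2 * O) ℚ.* (ι (suc D) ℚ.* q ℚ.+ 1ℚ) ℚ.+ ι 2 ℚ.* ι (suc D) ℚ.* v ℚ.+ u
    ≤⟨ ℚ.+-monoˡ-≤ u (ℚ.+-mono-≤ (ι-*-monoʳ-≤ (2 * O) Dq≤) (ℚ.≤-reflexive f≡)) ⟩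
  ι (2 * O) ℚ.* u ℚ.+ ι N ℚ.+ u
    ≡⟨ trans (ι-+ (2 * O * (2 * suc D) + N) (2 * suc D)) (cong (ℚ._+ u)
         (trans (ι-+ (2 * O * (2 * suc D)) N) (cong (ℚ._+ ι N) (ι-* (2 * O) (2 * suc D))))) ⟨
  ι (2 * O * (2 * suc D) + N + 2 * suc D) ∎)
  where
  open ℚ.≤-Reasoning
  open +-*-Solver
  u v : ℚ
  u = ι (2 * suc D)
  v = ι (F * N) ℚ.* (η ℚ.+ η)

  regroup : ∀ t d o q v → t ℚ.* d ℚ.* (o ℚ.* q ℚ.+ v ℚ.+ 1ℚ) ℚ.+ t ℚ.* o ≡
                          t ℚ.* o ℚ.* (d ℚ.* q ℚ.+ 1ℚ) ℚ.+ t ℚ.* d ℚ.* v ℚ.+ t ℚ.* d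
  regroup = solve 5 (λ t d o q v →
    t :* d :* (o :* q :+ v :+ con 1ℚ) :+ t :* o :=
    t :* o :* (d :* q :+ con 1ℚ) :+ t :* d :* v :+ t :* d) refl

  f≡ : ι 2 ℚ.* ι (suc D) ℚ.* v ≡ ι N
  f≡ = begin-equality
    ι 2 ℚ.* ι (suc D) ℚ.* (ι (F * N) ℚ.* (η ℚ.+ η))
      ≡⟨ cong (λ x → ι 2 ℚ.* ι (suc D) ℚ.* (x ℚ.* (η ℚ.+ η))) (ι-* F N) ⟩
    ι 2 ℚ.* ι (suc D) ℚ.* (ι F ℚ.* ι N ℚ.* (η ℚ.+ η))
      ≡⟨ solve 5 (λ t d v n h → t :* d :* (v :* n :* (h :+ h)) := (t :+ t) :* d :* v :* h :* n) refl
               (ι 2) (ι (suc D)) (ι F) (ι N) η ⟩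
    ι 4 ℚ.* ι (suc D) ℚ.* ι F ℚ.* η ℚ.* ι N
      ≡⟨ cong (λ x → x ℚ.* η ℚ.* ι N)
              (trans (ι-* (4 * suc D) F) (cong (ℚ._* ι F) (ι-* 4 (suc D)))) ⟨
    ι (4 * suc D * F) ℚ.* η ℚ.* ι N
      ≡⟨ cong (ℚ._* ι N) η≡ ⟩
    1ℚ ℚ.* ι N
      ≡⟨ ℚ.*-identityˡ (ι N) ⟩
    ι N ∎

-- From competitiveness to the lower bound

Competitive : ℝ → (ℕ → ℕ → ℝ) → Set
Competitive c d = ∀ n T₀ X → IsBST n T₀ → All (IsKey n) X →
  (GF OPT : Run T₀ X) → IsGreedy GF → IsOptimal OPT →
  fromℕ (cost GF) ≤ℝ (+ cost OPT / 1) · c +ℝ d n (length X)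

-- One η is the tolerance of the limit, the other the slack with which `_≤ℝ_` compares terms.
Tendsto0⇒≤ : ∀ {a : ℕ → ℝ} → Tendsto0 (λ k → a (suc k) /ℝ suc k) → ∀ η → 0ℚ ℚ.< η →
  ∃ λ M → ∀ m → M < m → ∃ λ I → ∀ i → I ≤ i → seq (a m) i ℚ.≤ ι m ℚ.* (η ℚ.+ η)
Tendsto0⇒≤ {a} a→0 η 0<η with M , small ← a→0 η 0<η = M , bound
  where
  bound : ∀ m → M < m → ∃ λ I → ∀ i → I ≤ i → seq (a m) i ℚ.≤ ι m ℚ.* (η ℚ.+ η)
  bound (suc m) (s≤s M≤m) with I , le ← proj₂ (small m M≤m) η 0<η = I , λ i I≤i →
    subst (ℚ._≤ ι (suc m) ℚ.* (η ℚ.+ η)) (cancel (seq (a (suc m)) i))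
          (ι-*-monoʳ-≤ (suc m) (le i I≤i))
    where
    cancel : ∀ x → ι (suc m) ℚ.* ((+ 1 / suc m) ℚ.* x) ≡ x
    cancel x = trans (sym (ℚ.*-assoc (ι (suc m)) (+ 1 / suc m) x))
      (trans (cong (ℚ._* x) (ι-reciprocal m)) (ℚ.*-identityˡ x))

reciprocal : ∀ m → 1 ≤ m → ∃ λ η → 0ℚ ℚ.< η × ι m ℚ.* η ≡ 1ℚ
reciprocal (suc m) _ =
  + 1 / suc m , ℚ.positive⁻¹ (+ 1 / suc m) {{ℚ.normalize-pos 1 (suc m)}} , ι-reciprocal m

record HardInstance (n K T G F N : ℕ) : Set where
  field
    {T₀}     : BinTree
    {X}      : List ℕ
    bst      : IsBST n T₀
    keys     : All (IsKey n) X
    length-X : length X ≡ F * N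
    GF       : Run T₀ X
    greedy   : IsGreedy GF
    GF-cost  : cost GF ≡ G
    cheap    : Run T₀ X
    cheap≤   : cost cheap ≤ K + T

hardInstance : ∀ k N → HardInstance (size (suc k)) (setup (suc k)) (optTotal (suc k) N) (greedyTotal (suc k) N)
                                    (3 ^ suc k) N
hardInstance k N = record
  { bst      = greedyTree-isBST (suc k)
  ; keys     = queries-keys (suc k) N
  ; length-X = trans (List.length-map (key (suc k) 0) (word (suc k) N)) (length-word (suc k) N)
  ; GF       = greedyRun (suc k) N
  ; greedy   = greedyRun-greedy (suc k) N
  ; GF-cost  = greedyRun-cost (suc k) N
  ; cheap    = proj₁ (cheapRun k N)
  ; cheap≤   = proj₂ (cheapRun k N)
  }

competitive-bound : ∀ {c d q I} D η {n K T G F N} → HardInstance n K T G F N →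
  Competitive c d → (∀ i → I ≤ i → seq c i ℚ.≤ q) →
  ι (suc D) ℚ.* q ℚ.+ 1ℚ ℚ.≤ ι (2 * suc D) →
  ι (4 * suc D * F) ℚ.* η ≡ 1ℚ →
  (∃ λ J → ∀ i → J ≤ i → seq (d n (F * N)) i ℚ.≤ ι (F * N) ℚ.* (η ℚ.+ η)) →
  ¬ ¬ (∃ λ O → O ≤ K + T × 2 * suc D * G + 2 * O ≤ 2 * O * (2 * suc D) + N + 2 * suc D)
competitive-bound {c} {d} {q} {I} D η {n} {K} {T} {G} {F} {N} hard comp c≤q Dq+1≤2D η≡ (J , d≤) none =
  optimal-exists cheap λ (OPT , opt) →
    none (cost OPT , ℕ.≤-trans (opt cheap) cheap≤ , inequality OPT opt)
  where
  open HardInstance hard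

  inequality : (OPT : Run T₀ X) → IsOptimal OPT →
    2 * suc D * G + 2 * cost OPT ≤ 2 * cost OPT * (2 * suc D) + N + 2 * suc D
  -- Slack 1 is good enough: it only adds a constant to the final bound on `N`.
  inequality OPT opt with L , GF≤ ← comp n T₀ X bst keys GF OPT greedy opt 1ℚ (ℚ.positive⁻¹ 1ℚ) =
    clear-denominators D F N G (cost OPT) (seq c i) q (seq (d n (F * N)) i) η
      (c≤q i (ℕ.m≤m⊔n I (J ℕ.⊔ L)))
      Dq+1≤2D
      (subst₂ (λ g m → ι g ℚ.≤ ι (cost OPT) ℚ.* seq c i ℚ.+ seq (d n m) i ℚ.+ 1ℚ) GF-cost length-X
              (GF≤ i (ℕ.≤-trans (ℕ.m≤n⊔m J L) (ℕ.m≤n⊔m I (J ℕ.⊔ L)))))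
      η≡
      (d≤ i (ℕ.≤-trans (ℕ.m≤m⊔n J L) (ℕ.m≤n⊔m I (J ℕ.⊔ L))))
    where
    i = I ℕ.⊔ (J ℕ.⊔ L)

rounds-contradict : ∀ {c d q I} D M η → Competitive c d → (∀ i → I ≤ i → seq c i ℚ.≤ q) →
  ι (suc D) ℚ.* q ℚ.+ 1ℚ ℚ.≤ ι (2 * suc D) →
  ι (4 * suc D * 3 ^ suc D) ℚ.* η ≡ 1ℚ →
  (∀ m → M < m → ∃ λ I → ∀ i → I ≤ i → seq (d (size (suc D)) m) i ℚ.≤ ι m ℚ.* (η ℚ.+ η)) →
  ∀ N → (4 * D + 2) * setup (suc D) + 2 * suc D + M < N → ⊥
rounds-contradict {c} {d} D M η comp c≤q Dq+1≤2D η≡ small N large =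
  competitive-bound {c} {d} D η (hardInstance D N) comp c≤q Dq+1≤2D η≡
    (small (3 ^ suc D * N) (ℕ.≤-trans (ℕ.≤-<-trans (ℕ.m≤n+m M _) large)
       (subst (_≤ 3 ^ suc D * N) (ℕ.*-identityˡ N) (ℕ.*-monoˡ-≤ N (ℕ.m^n>0 3 (suc D))))))
    λ (O , O≤ , h) → ℕ.<⇒≱ (ℕ.≤-<-trans (ℕ.m≤m+n _ M) large)
      (rounds-bounded D (setup (suc D)) (optTotal (suc D) N) (greedyTotal (suc D) N) (2 ^ suc D) (3 ^ suc D) O N
        (greedyTotal-optTotal (suc D) N) (optTotal-closed (suc D) N) (powers (suc D)) (ℕ.m^n>0 2 (suc D)) O≤ h)

-- The choices depend on each other in this order: q determines the level `suc D` and with it n,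
-- these determine η, the convergence of `d n` gives `M`, and the number of rounds is taken last,
-- beyond all bounds.
not-competitive-below-2 : ∀ {c d q I} → (∀ n → Tendsto0 (λ k → d n (suc k) /ℝ suc k)) →
  Competitive c d → (∀ i → I ≤ i → seq c i ℚ.≤ q) → ¬ q ℚ.< ι 2
not-competitive-below-2 {c} {d} {q} d→0 comp c≤q q<2
  with D , 1≤ ← archimedes (ι 2 ℚ.- q) (subst (ℚ._< ι 2 ℚ.- q) (ℚ.+-inverseʳ q) (ℚ.+-monoˡ-< (ℚ.- q) q<2))
  -- With this η the additive term, scaled by `2 * suc D`, uses up N, while the surplus of Greedy
  -- Future at that scale is at least 2N.
  with η , 0<η , η≡ ← reciprocal (4 * suc D * 3 ^ suc D) (ℕ.*-mono-≤ {1} {4 * suc D} (s≤s z≤n) (ℕ.m^n>0 3 (suc D)))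
  with M , small ← Tendsto0⇒≤ {d (size (suc D))} (d→0 (size (suc D))) η 0<η
  = rounds-contradict {c} {d} D M η comp c≤q (scale D 1≤) η≡ small _ ℕ.≤-refl
  where
  scale : ∀ D → 1ℚ ℚ.≤ ι (suc D) ℚ.* (ι 2 ℚ.- q) → ι (suc D) ℚ.* q ℚ.+ 1ℚ ℚ.≤ ι (2 * suc D)
  scale D 1≤ = begin
    ι (suc D) ℚ.* q ℚ.+ 1ℚ                            ≤⟨ ℚ.+-monoʳ-≤ (ι (suc D) ℚ.* q) 1≤ ⟩
    ι (suc D) ℚ.* q ℚ.+ ι (suc D) ℚ.* (ι 2 ℚ.- q)     ≡⟨ solve 3 (λ x y t → x :* y :+ x :* (t :- y) := t :* x) refl (ι (suc D)) q (ι 2) ⟩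
    ι 2 ℚ.* ι (suc D)                                 ≡⟨ ι-* 2 (suc D) ⟨
    ι (2 * suc D)                                     ∎
    where
    open ℚ.≤-Reasoning
    open +-*-Solver

theorem1 : (c : ℝ) (d : ℕ → ℕ → ℝ) →
    (∀ n → Tendsto0 (λ k → d n (suc k) /ℝ suc k)) →
    (∀ n T₀ X → IsBST n T₀ → All (IsKey n) X →
    (GF OPT : Run T₀ X) → IsGreedy GF → IsOptimal OPT →
    fromℕ (cost GF) ≤ℝ (+ cost OPT / 1) · c +ℝ d n (length X)) →
    fromℕ 2 ≤ℝ c
-- Order on reals is undecidable, so the case split is on the single rational `seq c I`, from which
-- later terms differ by at most ε/2. If `seq c I` plus ε/2 is below 2, this sum is a rational bound
-- on the tail of `c` that is refuted.
theorem1 c d d→0 comp ε 0<ε = I , decide (ι 2 ℚ.≤? seq c I ℚ.+ δ)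
  where
  δ : ℚ
  δ = ½ ℚ.* ε

  0<δ : 0ℚ ℚ.< δ
  0<δ = subst (ℚ._< δ) (ℚ.*-zeroʳ ½) (ℚ.*-monoʳ-<-pos ½ 0<ε)

  δ+δ≡ε : δ ℚ.+ δ ≡ ε
  δ+δ≡ε = trans (sym (ℚ.*-distribʳ-+ ε ½ ½)) (ℚ.*-identityˡ ε)

  I : ℕ
  I = proj₁ (cauchy c δ 0<δ)

  close : ∀ i j → I ≤ i → I ≤ j → seq c i ℚ.≤ seq c j ℚ.+ δ
  close i j I≤i I≤j = begin
    seq c i                              ≡⟨ solve 2 (λ x y → x := y :+ (x :- y)) refl (seq c i) (seq c j) ⟩
    seq c j ℚ.+ (seq c i ℚ.- seq c j)    ≤⟨ ℚ.+-monoʳ-≤ (seq c j) (ℚ.≤-trans (p≤∣p∣ (seq c i ℚ.- seq c j)) (proj₂ (cauchy c δ 0<δ) i j I≤i I≤j)) ⟩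
    seq c j ℚ.+ δ                        ∎
    where
    open ℚ.≤-Reasoning
    open +-*-Solver
    p≤∣p∣ : ∀ p → p ℚ.≤ ℚ.∣ p ∣
    p≤∣p∣ p with ℚ.≤-total 0ℚ p
    ... | inj₁ 0≤p = ℚ.≤-reflexive (sym (ℚ.0≤p⇒∣p∣≡p 0≤p))
    ... | inj₂ p≤0 = ℚ.≤-trans p≤0 (ℚ.0≤∣p∣ p)

  decide : Dec (ι 2 ℚ.≤ seq c I ℚ.+ δ) → ∀ i → I ≤ i → ι 2 ℚ.≤ seq c i ℚ.+ ε
  decide (yes 2≤) i I≤i = begin
    ι 2                    ≤⟨ 2≤ ⟩
    seq c I ℚ.+ δ          ≤⟨ ℚ.+-monoˡ-≤ δ (close I i ℕ.≤-refl I≤i) ⟩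
    seq c i ℚ.+ δ ℚ.+ δ    ≡⟨ trans (ℚ.+-assoc (seq c i) δ δ) (cong (seq c i ℚ.+_) δ+δ≡ε) ⟩
    seq c i ℚ.+ ε          ∎
    where open ℚ.≤-Reasoning
  decide (no 2≰) _ _ = contradiction (ℚ.≰⇒> 2≰)
    (not-competitive-below-2 {c} {d} d→0 comp λ i I≤i → close i I I≤i ℕ.≤-refl)
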